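{- Let $n \geq 4$ and let $W$ be a graph on $n$ vertices consisting of a cycle on $n-1$ vertices together with a single edge from a vertex of the cycle to the remaining vertex. Then for any $t \geq 2$ and integers $1 \leq k_1 \leq \cdots \leq k_t < n-1$ with $k_1 + \cdots + k_t = n$, the graph $\mathsf{FS}(W, K_{k_1,\ldots,k_t})$ is connected if and only if $n$ is even or $t > 2$.
   Context: All graphs are simple. For graphs $X, Y$ on $n$ vertices, the friends-and-strangers graph $\mathsf{FS}(X,Y)$ has as vertices all bijections $\sigma: V(X) \to V(Y)$; two bijections $\sigma, \sigma'$ are adjacent iff there is an edge $\{a,b\} \in E(X)$ with $\{\sigma(a),\sigma(b)\} \in E(Y)$, $\sigma'(a) = \sigma(b)$, $\sigma'(b) = \sigma(a)$, and $\sigma'(c) = \sigma(c)$ for all other $c$. $K_{k_1,\ldots,k_t}$ denotes the complete $t$-partite graph with partition classes of sizes $k_1,\ldots,k_t$. -}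

module Defs where

open import Data.Nat using (ℕ; zero; suc; _∸_; _<_; _<ᵇ_)
open import Data.Bool using (if_then_else_)
open import Data.Fin using (Fin; toℕ)
open import Data.Fin.Permutation using (Permutation′; _⟨$⟩ʳ_)
open import Data.List using (List; []; _∷_)
open import Data.Product using (Σ; _×_)
open import Data.Sum using (_⊎_)
open import Relation.Nullary using (¬_)
open import Relation.Binary.PropositionalEquality using (_≡_)
open import Relation.Binary.Construct.Closure.ReflexiveTransitive using (Star)

-- A graph on vertex set Fin n, given by its (symmetric, irreflexive) adjacency relation.
Graph : ℕ → Set₁
Graph n = Fin n → Fin n → Set

FSAdj : ∀ {n} → Graph n → Graph n → Permutation′ n → Permutation′ n → Set
FSAdj {n} X Y σ σ′ =
  Σ (Fin n) λ a → Σ (Fin n) λ b →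
    X a b × Y (σ ⟨$⟩ʳ a) (σ ⟨$⟩ʳ b)
    × (σ′ ⟨$⟩ʳ a ≡ σ ⟨$⟩ʳ b) × (σ′ ⟨$⟩ʳ b ≡ σ ⟨$⟩ʳ a)
    × ((c : Fin n) → ¬ (c ≡ a) → ¬ (c ≡ b) → σ′ ⟨$⟩ʳ c ≡ σ ⟨$⟩ʳ c)

FSConnected : ∀ {n} → Graph n → Graph n → Set
FSConnected {n} X Y = (σ τ : Permutation′ n) → Star (FSAdj X Y) σ τ

-- The graph W on Fin n (n ≥ 4): vertices 0,…,n-2 form a cycle
-- (i ~ i+1 for i+1 ≤ n-2, and 0 ~ n-2), and vertex n-1 is joined to vertex 0.
WDir : (n : ℕ) → ℕ → ℕ → Set
WDir n u v =
  ((v ≡ suc u) × (v < n ∸ 1))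
  ⊎ ((u ≡ 0) × (v ≡ n ∸ 2))
  ⊎ ((u ≡ 0) × (v ≡ n ∸ 1))

W : (n : ℕ) → Graph n
W n u v = WDir n (toℕ u) (toℕ v) ⊎ WDir n (toℕ v) (toℕ u)

-- Partition class of a vertex i (as a natural number) for classes of sizes ks,
-- vertices numbered consecutively: class 0 = {0,…,k₁-1}, class 1 = next k₂, etc.
block : List ℕ → ℕ → ℕ
block []       i = 0
block (k ∷ ks) i = if i <ᵇ k then 0 else suc (block ks (i ∸ k))

-- Complete multipartite graph K_{k₁,…,k_t} on Fin n (meant for sum ks = n).
CompleteMultipartite : (n : ℕ) → List ℕ → Graph n
CompleteMultipartite n ks u v = ¬ (block ks (toℕ u) ≡ block ks (toℕ v))

{-# OPTIONS --safe #-}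

-- Reading the people along the Hamiltonian path n-1, 0, 1, …, n-2 of W turns an arrangement into a word.
-- Neighbouring letters of different classes may be exchanged, and so may the second and the last letter
-- (the edge of W off the path). For a class c, path moves sort any word into the list as of the members
-- of c followed by the list bs of the others, so a word amounts to a pair (as , bs), and the extra edge
-- rotates as (possibly without its head) against bs. The graph is connected as soon as two neighbouring
-- members of c can be exchanged without changing bs, for every class c.
--
-- With at least three classes this is quick: bs can be rearranged so that its ends have different classes,
-- and exchanging the two ends of bs is possible both with and without exchanging the first two of as.
-- With two classes and n even, conjugates and commutators of the rotations give a 3-cycle on as that fixes
-- bs (up to exchanging the roles of as and bs, and apart from two classes of size three), hence all even
-- rearrangements of as; and some power of a rotation fixes bs and is odd on as.
-- For odd n both graphs are bipartite, and the parity of the permutation plus the number of members of one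
-- class on one side of W is invariant.
module Submission where

open import Defs
open import Data.Bool using (if_then_else_)
open import Data.Fin using (Fin; zero; suc; toℕ; fromℕ; fromℕ<; inject₁; _≟_) renaming (_≤_ to _≤ᶠ_)
open import Data.Fin.Permutation using (Permutation′; _⟨$⟩ʳ_; _⟨$⟩ˡ_; transpose; _∘ₚ_; inverseˡ; inverseʳ) renaming (id to idₚ)
import Data.Fin.Permutation.Components as PC
open import Data.Fin.Properties using (toℕ<n; toℕ-inject₁; toℕ-fromℕ; toℕ-fromℕ<; toℕ-injective; fromℕ≢inject₁; inject₁-injective; inject₁ℕ<)
open import Data.Fin.Relation.Unary.Top using (view; ‵fromℕ; ‵inject₁)
open import Data.List using (List; []; _∷_; _++_; _∷ʳ_; length; map; tabulate)
open import Data.List.Properties using (++-assoc; ++-identityʳ; ∷ʳ-++; length-++; length-map; length-tabulate; map-++; map-id; map-cong-local; ∷-injective; ∷ʳ-injective)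
open import Data.List.Membership.Propositional using (_∈_)
open import Data.List.Membership.Propositional.Properties using (∈-++⁻; ∈-map⁺; ∈-tabulate⁺)
open import Data.List.Membership.Propositional.Properties.WithK using (unique∧set⇒bag)
open import Data.List.Relation.Binary.BagAndSetEquality using (∼bag⇒↭)
open import Data.List.Relation.Binary.Permutation.Propositional as Perm using (_↭_; prep; swap; ↭-refl; ↭-sym; ↭-trans; ↭⇒↭ₛ)
open import Data.List.Relation.Binary.Permutation.Propositional.Properties using (↭-length; ∷↭∷ʳ; ++⁺ˡ; shift; ∈-resp-↭; Any-resp-↭)
import Data.List.Relation.Binary.Permutation.Setoid.Properties as PermSetoid
open import Data.List.Relation.Unary.All as All using (All; []; _∷_)
import Data.List.Relation.Unary.All.Properties as All
open import Data.List.Relation.Unary.AllPairs using ([]; _∷_)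
open import Data.List.Relation.Unary.Any as Any using (Any; here; there)
import Data.List.Relation.Unary.Any.Properties as Any
open import Data.List.Relation.Unary.Linked using (Linked; [-]; _∷_)
open import Data.List.Relation.Unary.Unique.Propositional using (Unique)
import Data.List.Relation.Unary.Unique.Propositional.Properties as Unique
open import Data.List.Reverse using (Reverse; reverseView; []; _∶_∶ʳ_)
open import Data.Nat using (ℕ; zero; suc; _+_; _*_; _≤_; _<_; _<ᵇ_; z≤n; s≤s; s≤s⁻¹; parity)
import Data.Nat as ℕ
open import Data.Nat.Divisibility using (_∣_; _∣0; divides; ∣-refl; ∣m∣n⇒∣m+n)
open import Data.Nat.Properties using (suc-injective; 0≢1+n; ≤-reflexive; ≤-trans; <-≤-trans; m≤m+n; m<m+n; +-comm; +-identityʳ; +-monoʳ-≤; +-monoʳ-<; +-cancelˡ-≡; +-cancelʳ-≤)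
open import Data.Parity using (Parity; 0ℙ; 1ℙ) renaming (_+_ to _+ℙ_; _*_ to _*ℙ_; _⁻¹ to _⁻¹ℙ)
open import Data.Parity.Properties using (+-homo-+; *-homo-*; *-zeroʳ; suc-homo-⁻¹; ⁻¹-involutive; p≢p⁻¹)
open import Data.Product as Prod using (∃; ∃₂; _×_; _,_; proj₁; proj₂)
open import Data.Sum as Sum using (_⊎_; inj₁; inj₂)
open import Data.Vec using (Vec; []; _∷_; lookup; sum; toList)
open import Function using (_∘_; id; mk⇔)
open import Function.Bundles using (_⇔_)
open import Level using (0ℓ)
open import Relation.Binary.Construct.Closure.ReflexiveTransitive as Star using (Star; ε; _◅_; _◅◅_)
open import Relation.Binary.Core using (Rel)
open import Relation.Binary.PropositionalEquality using (_≡_; _≢_; refl; sym; trans; cong; cong₂; subst; subst₂; ≢-sym; setoid; module ≡-Reasoning)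
open import Relation.Binary.Structures using (IsEquivalence)
open import Relation.Nullary using (¬_; yes; no; contradiction)
open import Relation.Nullary.Decidable using (dec-true; dec-false)

-- Adjacent transpositions of lists.

data Adj {A : Set} : Rel (List A) 0ℓ where
  adj : ∀ u x y v → Adj (u ++ x ∷ y ∷ v) (u ++ y ∷ x ∷ v)

Adj-sym : ∀ {A : Set} {as bs : List A} → Adj as bs → Adj bs as
Adj-sym (adj u x y v) = adj u y x v

Adj-∷ : ∀ {A : Set} {as bs : List A} a → Adj as bs → Adj (a ∷ as) (a ∷ bs)
Adj-∷ a (adj u x y v) = adj (a ∷ u) x y v

Adj⇒↭ : ∀ {A : Set} {as bs : List A} → Adj as bs → as ↭ bs
Adj⇒↭ (adj u x y v) = ++⁺ˡ u (swap x y ↭-refl)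

-- The index counts transpositions, so that the parity of a rearrangement can be computed.
data Swaps {A : Set} : ℕ → Rel (List A) 0ℓ where
  []  : ∀ {as} → Swaps 0 as as
  _∷_ : ∀ {n as bs cs} → Adj as bs → Swaps n bs cs → Swaps (suc n) as cs

Swaps-∷ : ∀ {A : Set} {n} {as bs : List A} a → Swaps n as bs → Swaps n (a ∷ as) (a ∷ bs)
Swaps-∷ a []       = []
Swaps-∷ a (s ∷ ss) = Adj-∷ a s ∷ Swaps-∷ a ss

Swaps-++ : ∀ {A : Set} {m n} {as bs cs : List A} → Swaps m as bs → Swaps n bs cs → Swaps (m + n) as cs
Swaps-++ []       ts = ts
Swaps-++ (s ∷ ss) ts = s ∷ Swaps-++ ss ts

Swaps⇒↭ : ∀ {A : Set} {n} {as bs : List A} → Swaps n as bs → as ↭ bs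
Swaps⇒↭ []       = ↭-refl
Swaps⇒↭ (s ∷ ss) = ↭-trans (Adj⇒↭ s) (Swaps⇒↭ ss)

moveBack : ∀ {A : Set} (x : A) xs v → Swaps (length xs) (x ∷ xs ++ v) (xs ++ x ∷ v)
moveBack x []       v = []
moveBack x (y ∷ xs) v = adj [] x y (xs ++ v) ∷ Swaps-∷ y (moveBack x xs v)

↭⇒Swaps : ∀ {A : Set} {as bs : List A} → as ↭ bs → ∃ λ n → Swaps n as bs
↭⇒Swaps Perm.refl = 0 , []
↭⇒Swaps (prep x p) = Prod.map₂ (Swaps-∷ x) (↭⇒Swaps p)
↭⇒Swaps (swap x y p) = Prod.map suc (λ ss → adj [] x y _ ∷ Swaps-∷ y (Swaps-∷ x ss)) (↭⇒Swaps p)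
↭⇒Swaps (Perm.trans p q) = _ , Swaps-++ (proj₂ (↭⇒Swaps p)) (proj₂ (↭⇒Swaps q))

-- Two rotations acting on a pair of lists.

ends : ∀ {A : Set} (xs : List A) → 2 ≤ length xs → ∃₂ λ x ys → ∃ λ y → xs ≡ x ∷ ys ∷ʳ y
ends (x ∷ xs) (s≤s p) with reverseView xs
ends (x ∷ .[])        (s≤s ()) | []
ends (x ∷ .(ys ∷ʳ y)) (s≤s p)  | ys ∶ _ ∶ʳ y = x , ys , y , refl

-- An equivalence on pairs (as , bs) that identifies each pair with the one obtained through the extra edge.
record Rotations (X Y : Set) : Set₁ where
  infix 4 _~_
  field
    _~_           : Rel (List X × List Y) 0ℓ
    isEquivalence : IsEquivalence _~_
    rotateˡ : ∀ x₀ x₁ xs ys y → (x₀ ∷ x₁ ∷ xs , ys ∷ʳ y) ~ (x₀ ∷ xs ∷ʳ x₁ , y ∷ ys)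
    rotateʳ : ∀ xs x y₀ y₁ ys → (xs ∷ʳ x , y₀ ∷ y₁ ∷ ys) ~ (x ∷ xs , y₀ ∷ ys ∷ʳ y₁)
  open IsEquivalence isEquivalence public renaming (refl to ~-refl; sym to ~-sym; trans to ~-trans)

  -- On `as`, a rotation of all but the head is followed by a full rotation backwards; on `bs` the
  -- two come in the other order. What remains on each list is one exchange.
  doubleSwap : ∀ x₀ x₁ xs y₀ ys y₁ → (x₀ ∷ x₁ ∷ xs , y₀ ∷ ys ∷ʳ y₁) ~ (x₁ ∷ x₀ ∷ xs , y₁ ∷ ys ∷ʳ y₀)
  doubleSwap x₀ x₁ xs y₀ ys y₁ =
    ~-trans (rotateˡ x₀ x₁ xs (y₀ ∷ ys) y₁) (rotateʳ (x₀ ∷ xs) x₁ y₁ y₀ ys)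

-- Exchanging the two lists turns `rotateˡ` into `rotateʳ`, so every result also holds with the
-- roles of `as` and `bs` exchanged.
mirror : ∀ {X Y} → Rotations X Y → Rotations Y X
mirror R = record
  { _~_           = λ s t → Prod.swap s ~ Prod.swap t
  ; isEquivalence = record { refl = ~-refl ; sym = ~-sym ; trans = ~-trans }
  ; rotateˡ       = λ x₀ x₁ xs ys y → rotateʳ ys y x₀ x₁ xs
  ; rotateʳ       = λ xs x y₀ y₁ ys → rotateˡ y₀ y₁ ys xs x
  }
  where open Rotations R

-- Moves that change `as` and restore `bs`.

module Pure {X Y : Set} (R : Rotations X Y) (B : List Y → Set)
            (B-resp : ∀ {bs bs′} → bs ↭ bs′ → B bs → B bs′)
            (B⇒2≤ : ∀ {bs} → B bs → 2 ≤ length bs) where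
  open Rotations R

  infix 4 _≈_
  -- Quantifying over all `bs` with `B`, a property stable under permutation, keeps the relation
  -- usable after a conjugation has rearranged `bs`.
  _≈_ : Rel (List X) 0ℓ
  as ≈ as′ = ∀ bs → B bs → (as , bs) ~ (as′ , bs)

  ≈-refl : ∀ {as} → as ≈ as
  ≈-refl bs _ = ~-refl

  ≈-sym : ∀ {as bs} → as ≈ bs → bs ≈ as
  ≈-sym p bs b = ~-sym (p bs b)

  ≈-trans : ∀ {as bs cs} → as ≈ bs → bs ≈ cs → as ≈ cs
  ≈-trans p q bs b = ~-trans (p bs b) (q bs b)

  -- `rotateʳ` acts on `bs` in the same way whatever `as` is, so conjugating by it leaves no trace
  -- on `bs`.
  unrotate : ∀ {xs x ys y} → xs ∷ʳ x ≈ ys ∷ʳ y → x ∷ xs ≈ y ∷ ys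
  unrotate p bs b with ends bs (B⇒2≤ b)
  ... | y₀ , ys , y₁ , refl =
    ~-trans (~-sym (rotateʳ _ _ y₀ y₁ ys))
      (~-trans (p _ (B-resp (prep y₀ (↭-sym (∷↭∷ʳ y₁ ys))) b)) (rotateʳ _ _ y₀ y₁ ys))

  rotate : ∀ {xs x ys y} → x ∷ xs ≈ y ∷ ys → xs ∷ʳ x ≈ ys ∷ʳ y
  rotate p [] b with () ← B⇒2≤ b
  rotate p (_ ∷ []) b with s≤s () ← B⇒2≤ b
  rotate p (y₀ ∷ y₁ ∷ ys) b =
    ~-trans (rotateʳ _ _ y₀ y₁ ys)
      (~-trans (p _ (B-resp (prep y₀ (∷↭∷ʳ y₁ ys)) b)) (~-sym (rotateʳ _ _ y₀ y₁ ys)))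

  -- Rotating `as` brings the block `f` to the front. The prefix `u` ends up behind `v`, which is
  -- why the assumption ranges over all tails.
  shift-≈ : ∀ {k} f f′ → (∀ v → length (f ++ v) ≡ k → f ++ v ≈ f′ ++ v) →
            ∀ u v → length (u ++ f ++ v) ≡ k → u ++ f ++ v ≈ u ++ f′ ++ v
  shift-≈ f f′ p []      v l = p v l
  shift-≈ {k} f f′ p (a ∷ u) v l = unrotate (subst₂ _≈_ (snoc f) (snoc f′)
      (shift-≈ f f′ p u (v ∷ʳ a) (trans (cong length (snoc f)) (trans (sym (↭-length (∷↭∷ʳ a (u ++ f ++ v)))) l))))
    where
      snoc : ∀ g → u ++ g ++ v ∷ʳ a ≡ (u ++ g ++ v) ∷ʳ a
      snoc g = trans (cong (u ++_) (sym (++-assoc g v (a ∷ [])))) (sym (++-assoc u (g ++ v) (a ∷ [])))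

  swaps-≈ : ∀ {k} → (∀ x y v → length (x ∷ y ∷ v) ≡ k → x ∷ y ∷ v ≈ y ∷ x ∷ v) →
            ∀ {as as′} → length as ≡ k → as ↭ as′ → as ≈ as′
  swaps-≈ p l q = go l (proj₂ (↭⇒Swaps q))
    where
      go : ∀ {n as as′} → length as ≡ _ → Swaps n as as′ → as ≈ as′
      go l [] = ≈-refl
      go l (s@(adj u x y v) ∷ ss) =
        ≈-trans (shift-≈ (x ∷ y ∷ []) (y ∷ x ∷ []) (p x y) u v l) (go (trans (sym (↭-length (Adj⇒↭ s))) l) ss)

  -- The effect on bs depends only on the position i and not on the elements of as, so that a swap
  -- can be undone after some other move has acted on as: see swap-conj.
  swap-lift : ∀ i bs → B bs → ∃ λ bs′ → B bs′ ×
              ∀ u x y v → length u ≡ i → (u ++ x ∷ y ∷ v , bs) ~ (u ++ y ∷ x ∷ v , bs′)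
  swap-lift zero bs b with ends bs (B⇒2≤ b)
  ... | y₀ , ys , y₁ , refl = y₁ ∷ ys ∷ʳ y₀ ,
        B-resp (↭-trans (prep y₀ (↭-sym (∷↭∷ʳ y₁ ys))) (↭-trans (swap y₀ y₁ ↭-refl) (prep y₁ (∷↭∷ʳ y₀ ys)))) b ,
        λ { [] x y v _ → doubleSwap x y v y₀ ys y₁ }
  swap-lift (suc i) bs b with ends bs (B⇒2≤ b)
  ... | y₀ , ys , y₁ , refl
    with b₁ ← B-resp (prep y₀ (↭-sym (∷↭∷ʳ y₁ ys))) b
    with swap-lift i (y₀ ∷ y₁ ∷ ys) b₁
  ... | [] , b₂ , _ with () ← B⇒2≤ b₂
  ... | _ ∷ [] , b₂ , _ with s≤s () ← B⇒2≤ b₂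
  ... | z₀ ∷ z₁ ∷ zs , b₂ , f = z₀ ∷ zs ∷ʳ z₁ , B-resp (prep z₀ (∷↭∷ʳ z₁ zs)) b₂ , λ
    { (a ∷ u) x y v l → ~-trans (~-sym (rotateʳ _ a y₀ y₁ ys)) (~-trans
        (subst₂ (λ as as′ → (as , _) ~ (as′ , _))
          (sym (++-assoc u (x ∷ y ∷ v) (a ∷ []))) (sym (++-assoc u (y ∷ x ∷ v) (a ∷ [])))
          (f u x y (v ∷ʳ a) (suc-injective l)))
        (rotateʳ _ a z₀ z₁ zs)) }

  -- Both exchanges happen at the same position, so they send `bs` to the same `bs′` and cancel
  -- there.
  swap-conj : ∀ u u′ {x y v x′ y′ v′} → length u ≡ length u′ →
              u ++ y ∷ x ∷ v ≈ u′ ++ y′ ∷ x′ ∷ v′ → u ++ x ∷ y ∷ v ≈ u′ ++ x′ ∷ y′ ∷ v′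
  swap-conj u u′ l p bs b with swap-lift (length u) bs b
  ... | bs′ , b′ , f =
    ~-trans (f u _ _ _ refl) (~-trans (p bs′ b′) (~-sym (f u′ _ _ _ (sym l))))

-- Even and odd rearrangements of `as` against a `bs` of fixed length.

flipFirst : ∀ {A : Set} → List A → List A
flipFirst (x ∷ y ∷ v) = y ∷ x ∷ v
flipFirst xs          = xs

parity-suc : ∀ n {p} → parity (suc n) ≡ p → parity n ≡ p ⁻¹ℙ
parity-suc n refl = sym (suc-homo-⁻¹ n)

module FixedLength {X Y : Set} (R : Rotations X Y) (K : ℕ) (2≤K : 2 ≤ K) where
  open Rotations R
  open Pure R (λ bs → length bs ≡ K) (λ p l → trans (sym (↭-length p)) l) (λ l → subst (2 ≤_) (sym l) 2≤K) public

  -- F inserts a fixed head into as or into bs, so this iterates rotateˡ and the inverse of rotateʳ alike.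
  rotations : (F : List X × List Y → List X × List Y) →
              (∀ x xs ys y → F (x ∷ xs , ys ∷ʳ y) ~ F (xs ∷ʳ x , y ∷ ys)) →
              ∀ {l} as → length as ≡ suc l → ∀ cs bs →
              ∃ λ as′ → Swaps (length cs * l) as as′ × F (as , bs ++ cs) ~ F (as′ , cs ++ bs)
  rotations F step as las [] bs = as , [] , subst (λ z → F (as , z) ~ F (as , bs)) (sym (++-identityʳ bs)) ~-refl
  rotations F step as las (c ∷ cs) bs with rotations F step as las cs (bs ∷ʳ c)
  ... | as₁ , ss , eq with trans (sym (↭-length (Swaps⇒↭ ss))) las
  rotations F step as las (c ∷ cs) bs | x ∷ xs , ss , eq | refl =
    xs ∷ʳ x ,
    subst (λ n → Swaps n as (xs ∷ʳ x)) (+-comm (length cs * length xs) _)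
      (Swaps-++ ss (subst (λ z → Swaps (length xs) (x ∷ z) (xs ∷ʳ x)) (++-identityʳ xs) (moveBack x xs []))) ,
    ~-trans (subst₂ (λ s t → F (as , s) ~ F (x ∷ xs , t)) (∷ʳ-++ bs c cs) (sym (++-assoc cs bs _)) eq)
            (step x xs (cs ++ bs) c)

  module _ {k : ℕ} (cycle₃ : ∀ a b c v → length (a ∷ b ∷ c ∷ v) ≡ k → a ∷ b ∷ c ∷ v ≈ b ∷ c ∷ a ∷ v) where

    -- A 3-cycle on `z`, `x`, `y` turns the exchange of `x` and `y` into that of `z` and `x`, one
    -- place further left. Repeating this reaches the front, so modulo 3-cycles all adjacent
    -- exchanges agree.
    swap≈flipFirst : ∀ {u} → Reverse u → ∀ x y v → length (u ++ x ∷ y ∷ v) ≡ k →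
                     u ++ y ∷ x ∷ v ≈ flipFirst (u ++ x ∷ y ∷ v)
    swap≈flipFirst [] x y v l = ≈-refl
    swap≈flipFirst (u ∶ r ∶ʳ z) x y v l = subst₂ (λ s t → s ≈ flipFirst t) (sym (∷ʳ-++ u z _)) (sym (∷ʳ-++ u z _))
      (≈-trans (≈-sym (shift-≈ (x ∷ z ∷ y ∷ []) (z ∷ y ∷ x ∷ []) (cycle₃ x z y) u v
                 (trans (↭-length (++⁺ˡ u (swap x z ↭-refl))) l′)))
               (swap≈flipFirst r z x (y ∷ v) l′))
      where
        l′ : length (u ++ z ∷ x ∷ y ∷ v) ≡ k
        l′ = trans (cong length (sym (∷ʳ-++ u z _))) l

    adj≈adj : ∀ {as bs cs} → length as ≡ k → Adj as bs → Adj as cs → bs ≈ cs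
    adj≈adj l s t = ≈-trans (first s l) (≈-sym (first t l))
      where
        first : ∀ {as bs} → Adj as bs → length as ≡ k → bs ≈ flipFirst as
        first (adj u x y v) l = swap≈flipFirst (reverseView u) x y v l

    length-adj : ∀ {as bs : List X} → Adj as bs → length as ≡ k → length bs ≡ k
    length-adj s l = trans (sym (↭-length (Adj⇒↭ s))) l

    -- The outer lists of two successive transpositions are both one transposition away from the
    -- middle one, so `adj≈adj` relates them.
    evenSwaps : ∀ {n as as′} → length as ≡ k → parity n ≡ 0ℙ → Swaps n as as′ → as ≈ as′
    evenSwaps l e [] = ≈-refl
    evenSwaps l e (s ∷ t ∷ ss) =
      ≈-trans (adj≈adj (length-adj s l) (Adj-sym s) t) (evenSwaps (length-adj t (length-adj s l)) e ss)

    -- Without its first transposition the odd sequence is even and can be undone by `evenSwaps`;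
    -- the transposition left over may be replaced by any other.
    oddLoop : ∀ {n as as′ cs bs} → length as ≡ k → length bs ≡ K → parity n ≡ 1ℙ → Swaps n as as′ →
              (as , bs) ~ (as′ , bs) → Adj as cs → (as , bs) ~ (cs , bs)
    oddLoop {suc n} l lb o (s ∷ ss) eq t =
      ~-trans eq (~-trans (~-sym (evenSwaps (length-adj s l) (parity-suc n o) ss _ lb)) (adj≈adj l s t _ lb))

    -- Depending on the parity of k, one of the rotations becomes an odd permutation of as by the time bs
    -- has come full circle.
    swapFirst : parity k ≡ parity K → ∀ x y v → length (x ∷ y ∷ v) ≡ k → x ∷ y ∷ v ≈ y ∷ x ∷ v
    swapFirst p x y v refl bs refl with parity (length v) in q
    -- Both `k` and `K` are odd: `K` rotations of the `k - 1` entries behind `x` make `K * (k - 2)`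
    -- transpositions, an odd number.
    ... | 1ℙ with rotations (λ { (as , bs) → x ∷ as , bs }) (rotateˡ x) (y ∷ v) refl bs []
    ... | as′ , ss , eq = oddLoop refl refl
       (trans (*-homo-* (length bs) (length v)) (cong₂ _*ℙ_ (sym p) q))
       (Swaps-∷ x ss) (subst (λ z → (_ , bs) ~ (_ , z)) (++-identityʳ bs) eq) (adj [] x y v)
    -- Both are even: with `b` kept in place, `K - 1` rotations of all of `as` make
    -- `(K - 1) * (k - 1)` transpositions, again an odd number.
    swapFirst p x y v refl (b ∷ bs) refl | 0ℙ
      with rotations (λ { (as , bs) → as , b ∷ bs }) (λ z zs ys w → ~-sym (rotateʳ zs z b w ys)) (x ∷ y ∷ v) refl bs []
    ... | as′ , ss , eq = oddLoop refl refl
       (trans (*-homo-* (length bs) (suc (length v))) (cong₂ _*ℙ_ (parity-suc (length bs) (sym p)) (parity-suc (suc (length v)) q)))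
       ss (subst (λ z → (_ , b ∷ bs) ~ (_ , b ∷ z)) (++-identityʳ bs) eq) (adj [] x y v)

-- 3-cycles built from the rotations.

ends₄ : ∀ {A : Set} (xs : List A) → 4 ≤ length xs →
        ∃₂ λ x ys → ∃₂ λ y₃ y₂ → ∃ λ y₁ → xs ≡ x ∷ ys ∷ʳ y₃ ∷ʳ y₂ ∷ʳ y₁
ends₄ (x ∷ xs) (s≤s p) with reverseView xs
... | zs₁ ∶ r₁ ∶ʳ y₁ with subst (3 ≤_) (sym (↭-length (∷↭∷ʳ y₁ zs₁))) p | r₁
... | s≤s p₂ | zs₂ ∶ r₂ ∶ʳ y₂ with subst (2 ≤_) (sym (↭-length (∷↭∷ʳ y₂ zs₂))) p₂ | r₂
... | s≤s p₃ | ys ∶ _ ∶ʳ y₃ = x , ys , y₃ , y₂ , y₁ , refl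

2≤2+ : ∀ {n} → 2 ≤ 2 + n
2≤2+ = s≤s (s≤s z≤n)

module _ {X Y : Set} (R : Rotations X Y) where
  open Rotations R

  -- On two entries `rotateʳ` leaves `bs` unchanged, while each `doubleSwap` exchanges `p` and `q`.
  -- Two of these, with a rotation of `as` in between, restore `bs` and compose to a 3-cycle.
  cycle₃-2 : ∀ a b c v → FixedLength._≈_ R 2 2≤2+ (a ∷ b ∷ c ∷ v) (b ∷ c ∷ a ∷ v)
  cycle₃-2 a b c v (p ∷ q ∷ []) refl =
    ~-trans (doubleSwap a b (c ∷ v) p [] q) (~-trans (~-sym (rotateʳ (a ∷ c ∷ v) b q p []))
      (~-trans (doubleSwap a c (v ∷ʳ b) q [] p) (rotateʳ (c ∷ a ∷ v) b p q [])))

  rotateˡ³ : ∀ x₀ x₁ x₂ x₃ xs p q r →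
             (x₀ ∷ x₁ ∷ x₂ ∷ x₃ ∷ xs , p ∷ q ∷ r ∷ []) ~ (x₀ ∷ xs ∷ʳ x₁ ∷ʳ x₂ ∷ʳ x₃ , p ∷ q ∷ r ∷ [])
  rotateˡ³ x₀ x₁ x₂ x₃ xs p q r =
    ~-trans (rotateˡ x₀ x₁ (x₂ ∷ x₃ ∷ xs) (p ∷ q ∷ []) r)
      (~-trans (rotateˡ x₀ x₂ (x₃ ∷ xs ∷ʳ x₁) (r ∷ p ∷ []) q)
               (rotateˡ x₀ x₃ (xs ∷ʳ x₁ ∷ʳ x₂) (q ∷ r ∷ []) p))

  -- With `z` kept in front, each `rotateˡ` transposes `x` and `y`. Three of them take `bs` once
  -- around and still amount to one transposition.
  swapFirst-33 : ∀ x y z → FixedLength._≈_ R 3 2≤2+ (x ∷ y ∷ z ∷ []) (y ∷ x ∷ z ∷ [])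
  swapFirst-33 x y z = rotate λ { (p ∷ q ∷ r ∷ []) refl →
      ~-trans (rotateˡ z x (y ∷ []) (p ∷ q ∷ []) r) (~-trans (rotateˡ z y (x ∷ []) (r ∷ p ∷ []) q)
        (rotateˡ z x (y ∷ []) (q ∷ r ∷ []) p)) }
    where open FixedLength R 3 2≤2+

  -- In `far`, a `doubleSwap` conjugated by `rotateˡ³` exchanges the first and fifth entries, and a
  -- plain one the first two; both exchange `p` and `r`, so `bs` is restored. Conjugation by two
  -- adjacent exchanges then carries the fifth place to the third.
  cycle₃-3 : ∀ a b c d e v → FixedLength._≈_ R 3 2≤2+ (a ∷ b ∷ c ∷ d ∷ e ∷ v) (b ∷ c ∷ a ∷ d ∷ e ∷ v)
  cycle₃-3 a b c d e v =
    swap-conj (a ∷ b ∷ []) (b ∷ c ∷ []) refl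
      (swap-conj (a ∷ b ∷ d ∷ []) (b ∷ c ∷ d ∷ []) refl (far a b d e c v))
    where
      open FixedLength R 3 2≤2+
      far : ∀ a b c d e v → a ∷ b ∷ c ∷ d ∷ e ∷ v ≈ b ∷ e ∷ c ∷ d ∷ a ∷ v
      far a b c d e v (p ∷ q ∷ r ∷ []) refl =
        ~-trans (rotateˡ³ a b c d (e ∷ v) p q r)
          (~-trans (doubleSwap a e (v ∷ʳ b ∷ʳ c ∷ʳ d) p (q ∷ []) r)
            (~-trans (~-sym (rotateˡ³ e b c d (a ∷ v) r q p))
              (doubleSwap e b (c ∷ d ∷ a ∷ v) r (q ∷ []) p)))

  -- doubleSwap conjugated by two rotations: for K ≥ 4 the exchanged elements of bs are disjoint from its ends,
  -- so the commutator with doubleSwap acts on as alone.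
  doubleSwap′ : ∀ x₀ x₁ x₂ x₃ xs ys y₃ y₂ y₁ →
                (x₀ ∷ x₁ ∷ x₂ ∷ x₃ ∷ xs , ys ∷ʳ y₃ ∷ʳ y₂ ∷ʳ y₁) ~ (x₃ ∷ x₁ ∷ x₂ ∷ x₀ ∷ xs , ys ∷ʳ y₂ ∷ʳ y₃ ∷ʳ y₁)
  doubleSwap′ x₀ x₁ x₂ x₃ xs ys y₃ y₂ y₁ =
    ~-trans (rotateˡ x₀ x₁ (x₂ ∷ x₃ ∷ xs) (ys ∷ʳ y₃ ∷ʳ y₂) y₁)
      (~-trans (rotateˡ x₀ x₂ (x₃ ∷ xs ∷ʳ x₁) (y₁ ∷ ys ∷ʳ y₃) y₂)
        (~-trans (doubleSwap x₀ x₃ (xs ∷ʳ x₁ ∷ʳ x₂) y₂ (y₁ ∷ ys) y₃)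
          (~-trans (~-sym (rotateˡ x₃ x₂ (x₀ ∷ xs ∷ʳ x₁) (y₁ ∷ ys ∷ʳ y₂) y₃))
                   (~-sym (rotateˡ x₃ x₁ (x₂ ∷ x₀ ∷ xs) (ys ∷ʳ y₂ ∷ʳ y₃) y₁)))))

  module _ {K : ℕ} (2≤K : 2 ≤ K) (4≤K : 4 ≤ K) where
    open FixedLength R K 2≤K

    -- On `as` the two moves are transpositions sharing just the first place, so their commutator is
    -- a 3-cycle on the first, second and fourth; `swap-conj` carries the fourth to the third.
    cycle₃-4 : ∀ a b c d v → a ∷ b ∷ c ∷ d ∷ v ≈ b ∷ c ∷ a ∷ d ∷ v
    cycle₃-4 a b c d v = swap-conj (a ∷ b ∷ []) (b ∷ c ∷ []) refl (commutator a b d c v)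
      where
        commutator : ∀ a b c d v → a ∷ b ∷ c ∷ d ∷ v ≈ b ∷ d ∷ c ∷ a ∷ v
        commutator a b c d v bs l with ends₄ bs (subst (4 ≤_) (sym l) 4≤K)
        ... | y₀ , ys , y₃ , y₂ , y₁ , refl =
          ~-trans (doubleSwap a b (c ∷ d ∷ v) y₀ (ys ∷ʳ y₃ ∷ʳ y₂) y₁)
            (~-trans (doubleSwap′ b a c d v (y₁ ∷ ys) y₃ y₂ y₀)
              (~-trans (doubleSwap d a (c ∷ b ∷ v) y₁ (ys ∷ʳ y₂ ∷ʳ y₃) y₀)
                (doubleSwap′ a d c b v (y₀ ∷ ys) y₂ y₃ y₁)))

-- Exchanging two entries when the lengths have equal parity.

swapFirst-mirror : ∀ {X Y : Set} (R : Rotations X Y) {k K : ℕ} (2≤k : 2 ≤ k) (2≤K : 2 ≤ K) →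
  (∀ x y v → length (x ∷ y ∷ v) ≡ K → FixedLength._≈_ (mirror R) k 2≤k (x ∷ y ∷ v) (y ∷ x ∷ v)) →
  ∀ x y v → length (x ∷ y ∷ v) ≡ k → FixedLength._≈_ R K 2≤K (x ∷ y ∷ v) (y ∷ x ∷ v)
swapFirst-mirror R {k} {K} 2≤k 2≤K p x y v l bs lb with ends bs (subst (2 ≤_) (sym lb) 2≤K)
-- Besides `x` and `y` this exchanges the ends of `bs`, which moves acting on `bs` alone put back.
... | y₀ , ys , y₁ , refl = ~-trans (doubleSwap x y v y₀ ys y₁)
    (FixedLength.swaps-≈ (mirror R) k 2≤k p (trans (↭-length (↭-sym q)) lb) (↭-sym q) (y ∷ x ∷ v) l)
  where
    open Rotations R
    q : y₀ ∷ ys ∷ʳ y₁ ↭ y₁ ∷ ys ∷ʳ y₀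
    q = ↭-trans (prep y₀ (↭-sym (∷↭∷ʳ y₁ ys))) (↭-trans (swap y₀ y₁ ↭-refl) (prep y₁ (∷↭∷ʳ y₀ ys)))

swapFirst-2 : ∀ {X Y : Set} (R : Rotations X Y) k → parity k ≡ 0ℙ →
  ∀ x y v → length (x ∷ y ∷ v) ≡ k → FixedLength._≈_ R 2 2≤2+ (x ∷ y ∷ v) (y ∷ x ∷ v)
swapFirst-2 R k p = FixedLength.swapFirst R 2 2≤2+ (λ a b c v _ → cycle₃-2 R a b c v) p

-- `cycle₃-3` needs five entries; among the smaller lengths parity leaves only three.
swapFirst-3 : ∀ {X Y : Set} (R : Rotations X Y) k → parity k ≡ 1ℙ →
  ∀ x y v → length (x ∷ y ∷ v) ≡ k → FixedLength._≈_ R 3 2≤2+ (x ∷ y ∷ v) (y ∷ x ∷ v)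
swapFirst-3 R k () x y [] refl
swapFirst-3 R k p x y (z ∷ []) refl = swapFirst-33 R x y z
swapFirst-3 R k () x y (_ ∷ _ ∷ []) refl
swapFirst-3 R k p x y (z ∷ z′ ∷ z″ ∷ v) l = FixedLength.swapFirst R 3 2≤2+ cyc p x y (z ∷ z′ ∷ z″ ∷ v) l
  where
    cyc : ∀ a b c w → length (a ∷ b ∷ c ∷ w) ≡ k → _
    cyc a b c (d ∷ e ∷ w) _ = cycle₃-3 R a b c d e w
    cyc a b c [] l′ with () ← trans l (sym l′)
    cyc a b c (_ ∷ []) l′ with () ← trans l (sym l′)

-- Without equal parities even the 3-cycles can be missing: FS(W, K₃,₄) has six components, not two.
swapFirst-even : ∀ {X Y : Set} (R : Rotations X Y) {k K} (2≤k : 2 ≤ k) (2≤K : 2 ≤ K) → parity k ≡ parity K →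
  ∀ x y v → length (x ∷ y ∷ v) ≡ k → FixedLength._≈_ R K 2≤K (x ∷ y ∷ v) (y ∷ x ∷ v)
swapFirst-even R {_} {1} _ (s≤s ())
swapFirst-even R {k} {2} _ (s≤s (s≤s z≤n)) p = swapFirst-2 R k p
swapFirst-even R {k} {3} _ (s≤s (s≤s z≤n)) p = swapFirst-3 R k p
swapFirst-even R {2} {K} (s≤s (s≤s z≤n)) 2≤K p = swapFirst-mirror R 2≤2+ 2≤K (swapFirst-2 (mirror R) K (sym p))
swapFirst-even R {3} {K} (s≤s (s≤s z≤n)) 2≤K p = swapFirst-mirror R 2≤2+ 2≤K (swapFirst-3 (mirror R) K (sym p))
swapFirst-even R {suc (suc (suc (suc k)))} {suc (suc (suc (suc K)))} _ 2≤K p =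
  FixedLength.swapFirst R _ 2≤K cyc p
  where
    cyc : ∀ a b c w → length (a ∷ b ∷ c ∷ w) ≡ suc (suc (suc (suc k))) → _
    cyc a b c [] ()
    cyc a b c (d ∷ w) _ = cycle₃-4 R 2≤K (s≤s (s≤s (s≤s (s≤s z≤n)))) a b c d w

-- Words of coloured letters, and a class singled out.

module Shuffling {V : Set} (col : V → ℕ) where

  data PathStep : Rel (List V) 0ℓ where
    path : ∀ u {x y} v → col x ≢ col y → PathStep (u ++ x ∷ y ∷ v) (u ++ y ∷ x ∷ v)

  data Step : Rel (List V) 0ℓ where
    path  : ∀ {w w′} → PathStep w w′ → Step w w′
    chord : ∀ a {b} u {c} → col b ≢ col c → Step (a ∷ b ∷ u ∷ʳ c) (a ∷ c ∷ u ∷ʳ b)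

  PathStep-∷ : ∀ {w w′} x → PathStep w w′ → PathStep (x ∷ w) (x ∷ w′)
  PathStep-∷ x (path u v ne) = path (x ∷ u) v ne

  infix 4 _⇝_ _↝_
  _⇝_ _↝_ : Rel (List V) 0ℓ
  _⇝_ = Star PathStep
  _↝_ = Star Step

  ⇝-sym : ∀ {w w′} → w ⇝ w′ → w′ ⇝ w
  ⇝-sym = Star.reverse λ { (path u v ne) → path u v (≢-sym ne) }

  ↝-sym : ∀ {w w′} → w ↝ w′ → w′ ↝ w
  ↝-sym = Star.reverse λ { (path (path u v ne)) → path (path u v (≢-sym ne)) ; (chord a u ne) → chord a u (≢-sym ne) }

  ⇝⇒↝ : ∀ {w w′} → w ⇝ w′ → w ↝ w′
  ⇝⇒↝ = Star.map path

  ⇝-∷ : ∀ {w w′} x → w ⇝ w′ → x ∷ w ⇝ x ∷ w′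
  ⇝-∷ x = Star.gmap (x ∷_) (PathStep-∷ x)

  ⇝-++ : ∀ {w w′} t → w ⇝ w′ → t ++ w ⇝ t ++ w′
  ⇝-++ []      p = p
  ⇝-++ (x ∷ t) p = ⇝-∷ x (⇝-++ t p)

  ++-⇝ : ∀ {w w′} t → w ⇝ w′ → w ++ t ⇝ w′ ++ t
  ++-⇝ t = Star.gmap (_++ t) λ { (path u {x} {y} v ne) →
    subst₂ PathStep (sym (++-assoc u _ t)) (sym (++-assoc u _ t)) (path u (v ++ t) ne) }

  ↝⇒↭ : ∀ {w w′} → w ↝ w′ → w ↭ w′
  ↝⇒↭ ε = ↭-refl
  ↝⇒↭ (path (path u v ne) ◅ ss) = ↭-trans (++⁺ˡ u (swap _ _ ↭-refl)) (↝⇒↭ ss)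
  ↝⇒↭ (chord a {b} u {c} ne ◅ ss) = ↭-trans (prep a (↭-trans (prep b (↭-sym (∷↭∷ʳ c u)))
     (↭-trans (swap b c ↭-refl) (prep c (∷↭∷ʳ b u))))) (↝⇒↭ ss)

  module Class (c : ℕ) where
    In Out : List V → Set
    In  = All (λ x → col x ≡ c)
    Out = All (λ y → col y ≢ c)

    private
      differ : ∀ {x y} → col x ≡ c → col y ≢ c → col y ≢ col x
      differ p q r = q (trans r p)

    pass : ∀ {y xs} → col y ≢ c → In xs → ∀ v → y ∷ xs ++ v ⇝ xs ++ y ∷ v
    pass q []                _ = ε
    pass q (_∷_ {x} {xs} p ps) v = path [] (xs ++ v) (differ p q) ◅ ⇝-∷ x (pass q ps v)

    passes : ∀ {ys xs} → Out ys → In xs → ∀ v → ys ++ xs ++ v ⇝ xs ++ ys ++ v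
    passes []       ps v = ε
    passes (q ∷ qs) ps v = ⇝-∷ _ (passes qs ps v) ◅◅ pass q ps _

    passEnd : ∀ {ys x} → Out ys → col x ≡ c → ys ∷ʳ x ⇝ x ∷ ys
    passEnd []       p = ε
    passEnd {y ∷ ys} (q ∷ qs) p = ⇝-∷ y (passEnd qs p) ◅◅ (path [] ys (differ p q) ◅ ε)

    -- After the chord has exchanged `x₁` and `y`, path steps carry `y` back past `xs` and `x₁`
    -- forward past the letters outside the class.
    word-rotateˡ : ∀ x₀ {x₁ xs ys y} → col x₁ ≡ c → In xs → Out ys → col y ≢ c →
                   x₀ ∷ x₁ ∷ xs ++ ys ∷ʳ y ↝ x₀ ∷ xs ∷ʳ x₁ ++ y ∷ ys
    word-rotateˡ x₀ {x₁} {xs} {ys} {y} p ps qs q =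
      subst (λ w → x₀ ∷ x₁ ∷ w ↝ x₀ ∷ xs ∷ʳ x₁ ++ y ∷ ys) (++-assoc xs ys (y ∷ []))
        (chord x₀ (xs ++ ys) (≢-sym (differ p q))
        ◅ subst₂ (λ w w′ → x₀ ∷ y ∷ w ↝ x₀ ∷ w′) (sym (++-assoc xs ys (x₁ ∷ []))) (sym (∷ʳ-++ xs x₁ (y ∷ ys)))
            (⇝⇒↝ (⇝-∷ x₀ (pass q ps (ys ∷ʳ x₁) ◅◅ ⇝-++ xs (passEnd (q ∷ qs) p)))))

    -- Path steps put `y₀` first, `y₁` second and `x` last; the chord exchanges `y₁` and `x`, and
    -- `y₀` then passes the members of the class.
    word-rotateʳ : ∀ {xs x y₀ y₁ ys} → In xs → col x ≡ c → col y₀ ≢ c → col y₁ ≢ c → Out ys →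
                   xs ∷ʳ x ++ y₀ ∷ y₁ ∷ ys ↝ x ∷ xs ++ y₀ ∷ ys ∷ʳ y₁
    word-rotateʳ {xs} {x} {y₀} {y₁} {ys} ps p q₀ q₁ qs =
      ⇝⇒↝ (⇝-sym (passes (q₀ ∷ q₁ ∷ []) (All.∷ʳ⁺ ps p) ys)) ◅◅
      subst₂ (λ w w′ → y₀ ∷ y₁ ∷ w ↝ y₀ ∷ y₁ ∷ w′) (sym (∷ʳ-++ xs x ys)) (sym (++-assoc xs ys (x ∷ [])))
        (⇝⇒↝ (⇝-++ (y₀ ∷ y₁ ∷ xs) (⇝-sym (passEnd qs p)))) ◅◅
      (chord y₀ (xs ++ ys) (differ p q₁) ◅
      subst (λ w → y₀ ∷ x ∷ w ↝ x ∷ xs ++ y₀ ∷ ys ∷ʳ y₁) (sym (++-assoc xs ys (y₁ ∷ [])))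
        (⇝⇒↝ (pass q₀ (p ∷ ps) (ys ∷ʳ y₁))))

    X Y : Set
    X = ∃ λ x → col x ≡ c
    Y = ∃ λ y → col y ≢ c

    ⌊_⌋ˣ : List X → List V
    ⌊_⌋ˣ = map proj₁
    ⌊_⌋ʸ : List Y → List V
    ⌊_⌋ʸ = map proj₁

    in-⌊⌋ : ∀ as → In ⌊ as ⌋ˣ
    in-⌊⌋ []             = []
    in-⌊⌋ ((_ , p) ∷ as) = p ∷ in-⌊⌋ as

    out-⌊⌋ : ∀ bs → Out ⌊ bs ⌋ʸ
    out-⌊⌋ []             = []
    out-⌊⌋ ((_ , q) ∷ bs) = q ∷ out-⌊⌋ bs

    word : List X × List Y → List V
    word (as , bs) = ⌊ as ⌋ˣ ++ ⌊ bs ⌋ʸ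

    rotations : Rotations X Y
    rotations = record
      { _~_           = λ s t → word s ↝ word t
      ; isEquivalence = record { refl = ε ; sym = ↝-sym ; trans = _◅◅_ }
      ; rotateˡ = λ { (x₀ , _) (x₁ , p) xs ys (y , q) → subst₂ (λ t t′ → x₀ ∷ x₁ ∷ ⌊ xs ⌋ˣ ++ t ↝ x₀ ∷ t′ ++ y ∷ ⌊ ys ⌋ʸ)
          (sym (map-++ proj₁ ys _)) (sym (map-++ proj₁ xs _)) (word-rotateˡ x₀ p (in-⌊⌋ xs) (out-⌊⌋ ys) q) }
      ; rotateʳ = λ { xs (x , p) (y₀ , q₀) (y₁ , q₁) ys → subst₂ (λ t t′ → t ++ y₀ ∷ y₁ ∷ ⌊ ys ⌋ʸ ↝ x ∷ ⌊ xs ⌋ˣ ++ y₀ ∷ t′)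
          (sym (map-++ proj₁ xs _)) (sym (map-++ proj₁ ys _)) (word-rotateʳ (in-⌊⌋ xs) p q₀ q₁ (out-⌊⌋ ys)) }
      }

    open Rotations rotations

    rearrange : ∀ as {bs bs′} → ⌊ bs ⌋ʸ ⇝ ⌊ bs′ ⌋ʸ → (as , bs) ~ (as , bs′)
    rearrange as p = ⇝⇒↝ (⇝-++ ⌊ as ⌋ˣ p)

    Varied : List Y → Set
    Varied bs = ∀ d → Any (λ y → col (proj₁ y) ≢ d) bs

    Varied⇒2≤ : ∀ {bs} → Varied bs → 2 ≤ length bs
    Varied⇒2≤ {[]} v with () ← v 0
    Varied⇒2≤ {(y , _) ∷ []} v with v (col y)
    ... | here ne = contradiction refl ne
    Varied⇒2≤ {_ ∷ _ ∷ _} v = s≤s (s≤s z≤n)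

    open Pure rotations Varied (λ p v d → Any-resp-↭ p (v d)) Varied⇒2≤

    -- One rotation makes the two ends of bs neighbours, where they can be exchanged.
    swap-differentEnds : ∀ x₀ x₁ xs y₀ ys y₁ → col (proj₁ y₀) ≢ col (proj₁ y₁) →
                         (x₀ ∷ x₁ ∷ xs , y₀ ∷ ys ∷ʳ y₁) ~ (x₁ ∷ x₀ ∷ xs , y₀ ∷ ys ∷ʳ y₁)
    swap-differentEnds x₀ x₁ xs y₀ ys y₁ ne =
      rotateˡ x₀ x₁ xs (y₀ ∷ ys) y₁ ◅◅
      rearrange (x₀ ∷ xs ∷ʳ x₁) {y₁ ∷ y₀ ∷ ys} {y₀ ∷ y₁ ∷ ys} (path [] _ (≢-sym ne) ◅ ε) ◅◅
      ↝-sym (rotateˡ x₀ x₁ xs (y₁ ∷ ys) y₀) ◅◅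
      doubleSwap x₀ x₁ xs y₁ ys y₀

    -- The first letter outside class `d` is preceded only by letters of `d`, and can be exchanged
    -- with each of them.
    bringToFront : ∀ {d ys} → Any (λ y → col (proj₁ y) ≢ d) ys →
                   ∃₂ λ y ys′ → col (proj₁ y) ≢ d × ⌊ ys ⌋ʸ ⇝ ⌊ y ∷ ys′ ⌋ʸ
    bringToFront {ys = z ∷ zs} (here ne) = z , zs , ne , ε
    bringToFront {d} {z ∷ zs} (there ps) with col (proj₁ z) ℕ.≟ d | bringToFront ps
    ... | no ne | _ = z , zs , ne , ε
    ... | yes e | y , ys′ , ne , p = y , z ∷ ys′ , ne ,
          ⇝-∷ _ p ◅◅ (path [] _ (λ e′ → ne (trans (sym e′) e)) ◅ ε)

    swapFirst-varied : ∀ x y v → x ∷ y ∷ v ≈ y ∷ x ∷ v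
    swapFirst-varied x y v bs b with reverseView bs
    ... | [] with () ← b 0
    swapFirst-varied x y v .(ys ∷ʳ z) b | ys ∶ _ ∶ʳ z with Any.++⁻ ys (b (col (proj₁ z)))
    ... | inj₂ (here ne) = contradiction refl ne
    ... | inj₁ p with bringToFront p
    ... | y′ , ys′ , ne , r =
          move (x ∷ y ∷ v) ◅◅ swap-differentEnds x y v y′ ys′ z ne ◅◅ ↝-sym (move (y ∷ x ∷ v))
      where
        move : ∀ as → (as , ys ∷ʳ z) ~ (as , y′ ∷ ys′ ∷ʳ z)
        move as = rearrange as {ys ∷ʳ z} {y′ ∷ ys′ ∷ʳ z} (subst₂ _⇝_ (sym (map-++ proj₁ ys _)) (sym (map-++ proj₁ (y′ ∷ ys′) _)) (++-⇝ _ r))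

    split : ∀ u → ∃₂ λ as bs → u ⇝ word (as , bs)
    split [] = [] , [] , ε
    split (x ∷ u) with split u | col x ℕ.≟ c
    ... | as , bs , p | yes e = (x , e) ∷ as , bs , ⇝-∷ x p
    ... | as , bs , p | no ne = as , (x , ne) ∷ bs , ⇝-∷ x p ◅◅ pass ne (in-⌊⌋ as) ⌊ bs ⌋ʸ

    -- The resulting lists are chosen before `x` and `y`, so the same moves can be reversed once the
    -- pair has been exchanged.
    gather : ∀ u v → ∃₂ λ as₁ as₂ → ∃ λ bs → ∀ (x y : X) →
             u ++ proj₁ x ∷ proj₁ y ∷ v ↝ word (as₁ ++ x ∷ y ∷ as₂ , bs)
    gather u v with split u | split v
    ... | as₁ , bs₁ , p | as₂ , bs₂ , q = as₁ , as₂ , bs₁ ++ bs₂ , λ x y → ⇝⇒↝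
      (++-⇝ (proj₁ x ∷ proj₁ y ∷ v) p ◅◅
       ⇝-++ (word (as₁ , bs₁)) (⇝-∷ _ (⇝-∷ _ q)) ◅◅
       subst₂ _⇝_ (sym (++-assoc ⌊ as₁ ⌋ˣ ⌊ bs₁ ⌋ʸ _))
         (trans (sym (++-assoc ⌊ as₁ ⌋ˣ _ _)) (cong₂ _++_ (sym (map-++ proj₁ as₁ _)) (sym (map-++ proj₁ bs₁ bs₂))))
         (⇝-++ ⌊ as₁ ⌋ˣ (passes (out-⌊⌋ bs₁) (in-⌊⌋ (x ∷ y ∷ as₂)) ⌊ bs₂ ⌋ʸ)))

    ∈-out : ∀ {as bs w r} → word (as , bs) ↭ w → r ∈ w → col r ≢ c → r ∈ ⌊ bs ⌋ʸ
    ∈-out {as} p r∈w ne with ∈-++⁻ ⌊ as ⌋ˣ (∈-resp-↭ (↭-sym p) r∈w)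
    ... | inj₁ r∈as = contradiction (All.lookup (in-⌊⌋ as) r∈as) ne
    ... | inj₂ r∈bs = r∈bs

  ∈∈⇒2≤ : ∀ {r s : V} {w} → r ∈ w → s ∈ w → r ≢ s → 2 ≤ length w
  ∈∈⇒2≤ (here refl) (here refl) ne = contradiction refl ne
  ∈∈⇒2≤ {w = _ ∷ _ ∷ _} (here refl) (there _) ne = s≤s (s≤s z≤n)
  ∈∈⇒2≤ {w = _ ∷ _ ∷ _} (there _) _ ne = s≤s (s≤s z≤n)

  -- The alternatives match the two connected cases: two letters outside `c` in a word of even
  -- length, or letters of two further classes.
  Rich : List V → ℕ → Set
  Rich w c = ∃₂ λ r s → r ∈ w × s ∈ w × col r ≢ c × col s ≢ c × (r ≢ s × parity (length w) ≡ 0ℙ ⊎ col r ≢ col s)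

  ≡-parity : ∀ p q → p +ℙ q ≡ 0ℙ → p ≡ q
  ≡-parity 0ℙ q  e = sym e
  ≡-parity 1ℙ 1ℙ e = refl

  adjacent-↝ : ∀ u x y v {w₀} → (∀ c → Rich w₀ c) → u ++ x ∷ y ∷ v ↭ w₀ → u ++ x ∷ y ∷ v ↝ u ++ y ∷ x ∷ v
  adjacent-↝ u x y v {w₀} rich p with col x ℕ.≟ col y
  ... | no ne = path (path u v ne) ◅ ε
  ... | yes e with Class.gather (col x) u v | rich (col x)
  ... | as₁ , as₂ , bs , g | r , s , r∈ , s∈ , r≢ , s≢ , alt =
      g x′ y′ ◅◅ pureSwap alt ◅◅ ↝-sym (g y′ x′)
    where
      open Class (col x)
      open Rotations rotations using (_~_)
      x′ y′ : X
      x′ = x , refl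
      y′ = y , sym e
      q : word (as₁ ++ x′ ∷ y′ ∷ as₂ , bs) ↭ w₀
      q = ↭-trans (↭-sym (↝⇒↭ (g x′ y′))) p
      r∈bs : r ∈ ⌊ bs ⌋ʸ
      r∈bs = ∈-out {as₁ ++ x′ ∷ y′ ∷ as₂} {bs} q r∈ r≢
      s∈bs : s ∈ ⌊ bs ⌋ʸ
      s∈bs = ∈-out {as₁ ++ x′ ∷ y′ ∷ as₂} {bs} q s∈ s≢
      anyBs : ∀ {t d} → t ∈ ⌊ bs ⌋ʸ → col t ≢ d → Any (λ z → col (proj₁ z) ≢ d) bs
      anyBs t∈ ne = Any.map (λ { refl → ne }) (Any.map⁻ t∈)
      varied : col r ≢ col s → Varied bs
      varied ne d with col r ℕ.≟ d
      ... | no r≢d = anyBs r∈bs r≢d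
      ... | yes refl = anyBs s∈bs (≢-sym ne)
      2≤as : 2 ≤ length (as₁ ++ x′ ∷ y′ ∷ as₂)
      2≤as = subst (2 ≤_) (sym (trans (length-++ as₁) (+-comm (length as₁) _))) (s≤s (s≤s z≤n))
      2≤bs : r ≢ s → 2 ≤ length bs
      2≤bs ne = subst (2 ≤_) (length-map proj₁ bs) (∈∈⇒2≤ r∈bs s∈bs ne)
      pureSwap : r ≢ s × parity (length w₀) ≡ 0ℙ ⊎ col r ≢ col s →
                 (as₁ ++ x′ ∷ y′ ∷ as₂ , bs) ~ (as₁ ++ y′ ∷ x′ ∷ as₂ , bs)
      pureSwap (inj₂ ne) = Pure.shift-≈ rotations Varied (λ p v d → Any-resp-↭ p (v d)) Varied⇒2≤
        (x′ ∷ y′ ∷ []) (y′ ∷ x′ ∷ []) (λ w _ → swapFirst-varied x′ y′ w) as₁ as₂ refl bs (varied ne)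
      pureSwap (inj₁ (ne , even)) = FixedLength.shift-≈ rotations (length bs) (2≤bs ne)
        (x′ ∷ y′ ∷ []) (y′ ∷ x′ ∷ []) (swapFirst-even rotations 2≤as (2≤bs ne) sameParity x′ y′) as₁ as₂ refl bs refl
        where
          sameParity : parity (length (as₁ ++ x′ ∷ y′ ∷ as₂)) ≡ parity (length bs)
          sameParity = ≡-parity _ _ (trans (sym (+-homo-+ (length (as₁ ++ x′ ∷ y′ ∷ as₂)) (length bs)))
            (trans (cong parity (trans (cong₂ _+_ (sym (length-map proj₁ (as₁ ++ x′ ∷ y′ ∷ as₂))) (sym (length-map proj₁ bs)))
              (trans (sym (length-++ ⌊ as₁ ++ x′ ∷ y′ ∷ as₂ ⌋ˣ)) (↭-length q)))) even))

  swaps-↝ : ∀ {w₀} → (∀ c → Rich w₀ c) → ∀ {n w w′} → w ↭ w₀ → Swaps n w w′ → w ↝ w′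
  swaps-↝ rich p [] = ε
  swaps-↝ rich p (s@(adj u x y v) ∷ ss) =
    adjacent-↝ u x y v rich p ◅◅ swaps-↝ rich (↭-trans (↭-sym (Adj⇒↭ s)) p) ss

-- Words read along the Hamiltonian path of `W`, and lifting their moves to walks.

tabulate-∷ʳ : ∀ {A : Set} n (f : Fin (suc n) → A) → tabulate f ≡ tabulate (f ∘ inject₁) ∷ʳ f (fromℕ n)
tabulate-∷ʳ zero    f = refl
tabulate-∷ʳ (suc n) f = cong (f zero ∷_) (tabulate-∷ʳ n (f ∘ suc))

tabulate-linked : ∀ {A : Set} {R : A → A → Set} n (f : Fin (suc n) → A) →
                  (∀ i → R (f (inject₁ i)) (f (suc i))) → Linked R (tabulate f)
tabulate-linked zero    f r = [-]
tabulate-linked (suc n) f r = r zero ∷ tabulate-linked n (f ∘ suc) (r ∘ suc)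

linked-++ : ∀ {A : Set} {R : A → A → Set} u {x y v} → Linked R (u ++ x ∷ y ∷ v) → R x y
linked-++ []          (r ∷ _)  = r
linked-++ (_ ∷ [])    (_ ∷ rs) = linked-++ [] rs
linked-++ (_ ∷ u@(_ ∷ _)) (_ ∷ rs) = linked-++ u rs

map-++⁻ : ∀ {A B : Set} (f : A → B) ws us {vs} → map f ws ≡ us ++ vs →
          ∃₂ λ us′ vs′ → ws ≡ us′ ++ vs′ × map f us′ ≡ us × map f vs′ ≡ vs
map-++⁻ f ws [] e = [] , ws , refl , refl , e
map-++⁻ f (w ∷ ws) (u ∷ us) e with ∷-injective e
... | refl , e′ with map-++⁻ f ws us e′
... | us′ , vs′ , refl , e₁ , e₂ = w ∷ us′ , vs′ , refl , cong (f w ∷_) e₁ , e₂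

Unique-resp-↭ : ∀ {A : Set} {xs ys : List A} → xs ↭ ys → Unique xs → Unique ys
Unique-resp-↭ {A} p = PermSetoid.Unique-resp-↭ (setoid A) (↭⇒↭ₛ p)

map-exchange : ∀ {A B : Set} (f g : A → B) us {x y} ms vs → Unique (us ++ x ∷ ms ++ y ∷ vs) →
               g x ≡ f y → g y ≡ f x → (∀ z → z ≢ x → z ≢ y → g z ≡ f z) →
               map g (us ++ x ∷ ms ++ y ∷ vs) ≡ map f us ++ f y ∷ map f ms ++ f x ∷ map f vs
map-exchange f g us {x} {y} ms vs uniq gx gy gz
  with Unique-resp-↭ (↭-trans (shift x us _) (prep x (↭-trans (++⁺ˡ us (shift y ms vs)) (shift y us _)))) uniq
... | (_ ∷ x≢) ∷ y≢ ∷ _ =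
    trans (map-++ g us _) (cong₂ _++_ (rest us (All.++⁻ˡ us x≢) (All.++⁻ˡ us y≢)) (cong₂ _∷_ gx
      (trans (map-++ g ms _) (cong₂ _++_ (rest ms (All.++⁻ˡ ms (All.++⁻ʳ us x≢)) (All.++⁻ˡ ms (All.++⁻ʳ us y≢)))
        (cong₂ _∷_ gy (rest vs (All.++⁻ʳ ms (All.++⁻ʳ us x≢)) (All.++⁻ʳ ms (All.++⁻ʳ us y≢))))))))
  where
    rest : ∀ ws → All (x ≢_) ws → All (y ≢_) ws → map g ws ≡ map f ws
    rest ws p q = map-cong-local (All.zipWith (λ { (a , b) → gz _ (≢-sym a) (≢-sym b) }) (p , q))

transpose-i : ∀ {n} (i j : Fin n) → PC.transpose i j i ≡ j
transpose-i i j rewrite dec-true (i ≟ i) refl = refl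

transpose-j : ∀ {n} (i j : Fin n) → PC.transpose i j j ≡ i
transpose-j i j with j ≟ i
... | yes refl = refl
... | no _ rewrite dec-true (j ≟ j) refl = refl

transpose-k : ∀ {n} (i j k : Fin n) → k ≢ i → k ≢ j → PC.transpose i j k ≡ k
transpose-k i j k k≢i k≢j rewrite dec-false (k ≟ i) k≢i | dec-false (k ≟ j) k≢j = refl

module Hamiltonian (l : ℕ) where
  n : ℕ
  n = 3 + l

  V : Set
  V = Fin n

  pendant end : V
  pendant = fromℕ (2 + l)
  end = inject₁ (suc (fromℕ l))

  middle route : List V
  middle = tabulate {n = l} (inject₁ ∘ suc ∘ inject₁)
  route  = pendant ∷ tabulate {n = 2 + l} inject₁

  route-ends : route ≡ pendant ∷ zero ∷ middle ∷ʳ end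
  route-ends = cong (λ w → pendant ∷ zero ∷ w) (tabulate-∷ʳ l (inject₁ ∘ suc))

  route-unique : Unique route
  route-unique = All.tabulate⁺ (λ i → fromℕ≢inject₁ {i = i}) ∷ Unique.tabulate⁺ {f = inject₁} inject₁-injective

  ∈-route : ∀ i → i ∈ route
  ∈-route i with view i
  ... | ‵fromℕ     = here refl
  ... | ‵inject₁ j = there (∈-tabulate⁺ {f = inject₁} j)

  route-linked : Linked (W n) route
  route-linked = inj₂ (inj₂ (inj₂ (refl , toℕ-fromℕ (2 + l)))) ∷
    tabulate-linked {R = W n} (suc l) inject₁ λ i → inj₁ (inj₁ (cong suc (trans (toℕ-inject₁ i) (sym (toℕ-inj² i))) , inject₁ℕ< (suc i)))
    where
      toℕ-inj² : ∀ {m} (i : Fin m) → toℕ (inject₁ (inject₁ i)) ≡ toℕ i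
      toℕ-inj² i = trans (toℕ-inject₁ (inject₁ i)) (toℕ-inject₁ i)

  chord-edge : W n zero end
  chord-edge = inj₁ (inj₂ (inj₁ (refl , trans (toℕ-inject₁ (suc (fromℕ l))) (cong suc (toℕ-fromℕ l)))))

  wordOf : Permutation′ n → List V
  wordOf σ = map (σ ⟨$⟩ʳ_) route

  ∈-wordOf : ∀ σ i → i ∈ wordOf σ
  ∈-wordOf σ i = subst (_∈ wordOf σ) (inverseʳ σ) (∈-map⁺ (σ ⟨$⟩ʳ_) (∈-route (σ ⟨$⟩ˡ i)))

  wordOf-unique : ∀ σ → Unique (wordOf σ)
  wordOf-unique σ = Unique.map⁺ (λ e → trans (sym (inverseˡ σ)) (trans (cong (σ ⟨$⟩ˡ_) e) (inverseˡ σ))) route-unique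

  wordOf-↭ : ∀ σ τ → wordOf σ ↭ wordOf τ
  wordOf-↭ σ τ = ∼bag⇒↭ (unique∧set⇒bag (wordOf-unique σ) (wordOf-unique τ)
    (mk⇔ (λ _ → ∈-wordOf τ _) (λ _ → ∈-wordOf σ _)))

  wordOf-ends : ∀ σ → wordOf σ ≡ (σ ⟨$⟩ʳ pendant) ∷ (σ ⟨$⟩ʳ zero) ∷ map (σ ⟨$⟩ʳ_) middle ∷ʳ (σ ⟨$⟩ʳ end)
  wordOf-ends σ = trans (cong (map (σ ⟨$⟩ʳ_)) route-ends) (cong (λ w → (σ ⟨$⟩ʳ pendant) ∷ (σ ⟨$⟩ʳ zero) ∷ w) (map-++ (σ ⟨$⟩ʳ_) middle _))

  length-wordOf : ∀ σ → length (wordOf σ) ≡ n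
  length-wordOf σ = trans (length-map (σ ⟨$⟩ʳ_) route) (cong suc (length-tabulate {n = 2 + l} (inject₁ {2 + l})))

  map-≗ : ∀ {f g : V → V} → map f route ≡ map g route → ∀ i → f i ≡ g i
  map-≗ e i = go e (∈-route i)
    where
      go : ∀ {f g : V → V} {ws i} → map f ws ≡ map g ws → i ∈ ws → f i ≡ g i
      go e (here refl) = proj₁ (∷-injective e)
      go e (there i∈) = go (proj₂ (∷-injective e)) i∈

  module Colouring (ks : List ℕ) where
    col : V → ℕ
    col v = block ks (toℕ v)

    Y : Graph n
    Y = CompleteMultipartite n ks

    open Shuffling col

    -- This covers both kinds of moves: `ms` is empty for an edge of the path and is `middle` for
    -- the chord.
    exchange : ∀ σ us {x} ms {y} vs → route ≡ us ++ x ∷ ms ++ y ∷ vs → W n x y → Y (σ ⟨$⟩ʳ x) (σ ⟨$⟩ʳ y) →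
               ∃ λ σ′ → FSAdj (W n) Y σ σ′ ×
               wordOf σ′ ≡ map (σ ⟨$⟩ʳ_) us ++ (σ ⟨$⟩ʳ y) ∷ map (σ ⟨$⟩ʳ_) ms ++ (σ ⟨$⟩ʳ x) ∷ map (σ ⟨$⟩ʳ_) vs
    exchange σ us {x} ms {y} vs r w c =
      σ′ , (x , y , w , c , σ′x , σ′y , σ′z) ,
      trans (cong (map (σ′ ⟨$⟩ʳ_)) r)
        (map-exchange (σ ⟨$⟩ʳ_) (σ′ ⟨$⟩ʳ_) us ms vs (subst Unique r route-unique) σ′x σ′y σ′z)
      where
        σ′ : Permutation′ n
        σ′ = transpose x y ∘ₚ σ
        σ′x : σ′ ⟨$⟩ʳ x ≡ σ ⟨$⟩ʳ y
        σ′x = cong (σ ⟨$⟩ʳ_) (transpose-i x y)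
        σ′y : σ′ ⟨$⟩ʳ y ≡ σ ⟨$⟩ʳ x
        σ′y = cong (σ ⟨$⟩ʳ_) (transpose-j x y)
        σ′z : ∀ z → z ≢ x → z ≢ y → σ′ ⟨$⟩ʳ z ≡ σ ⟨$⟩ʳ z
        σ′z z z≢x z≢y = cong (σ ⟨$⟩ʳ_) (transpose-k x y z z≢x z≢y)

    liftStep : ∀ σ {w w′} → wordOf σ ≡ w → Step w w′ → ∃ λ σ′ → FSAdj (W n) Y σ σ′ × wordOf σ′ ≡ w′
    liftStep σ e (path (path u v ne)) with map-++⁻ (σ ⟨$⟩ʳ_) route u e
    ... | us , x ∷ y ∷ vs , r , refl , refl =
          exchange σ us [] vs r (linked-++ us (subst (Linked (W n)) r route-linked)) ne
    liftStep σ e (chord a u ne) with ∷-injective (trans (sym e) (wordOf-ends σ))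
    ... | refl , e₁ with ∷-injective e₁
    ... | refl , e₂ with ∷ʳ-injective u (map (σ ⟨$⟩ʳ_) middle) e₂
    ... | refl , refl = exchange σ (pendant ∷ []) middle [] route-ends chord-edge ne

    liftSteps : ∀ σ {w w′} → wordOf σ ≡ w → w ↝ w′ → ∃ λ σ′ → Star (FSAdj (W n) Y) σ σ′ × wordOf σ′ ≡ w′
    liftSteps σ e ε = σ , ε , e
    liftSteps σ e (s ◅ ss) with liftStep σ e s
    ... | σ₁ , f , e₁ with liftSteps σ₁ e₁ ss
    ... | σ₂ , fs , e₂ = σ₂ , f ◅ fs , e₂

    -- The exchange takes place where the class first changes along the word.
    bichromaticStep : ∀ x w → Any (λ y → col y ≢ col x) w → ∃ λ w′ → PathStep (x ∷ w) w′
    bichromaticStep x (y ∷ w) p with col x ℕ.≟ col y | p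
    ... | no ne | _        = _ , path [] w ne
    ... | yes e | here ne  = contradiction (sym e) ne
    ... | yes e | there p′ with bichromaticStep y w (Any.map (λ ne e′ → ne (trans e′ (sym e))) p′)
    ... | _ , s = _ , PathStep-∷ x s

    -- `FSAdj` sees only values, so an edge can be retraced to any permutation agreeing pointwise
    -- with its start.
    FSAdj-flip : ∀ {σ σ′ τ} → FSAdj (W n) Y σ σ′ → (∀ i → σ ⟨$⟩ʳ i ≡ τ ⟨$⟩ʳ i) → FSAdj (W n) Y σ′ τ
    FSAdj-flip (a , b , w , c , σ′a , σ′b , σ′z) eq = a , b , w ,
      (λ e → c (trans (cong col (sym σ′b)) (trans (sym e) (cong col σ′a)))) ,
      trans (sym (eq a)) (sym σ′b) , trans (sym (eq b)) (sym σ′a) , λ z z≢a z≢b → trans (sym (eq z)) (sym (σ′z z z≢a z≢b))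

    -- Permutations that agree pointwise need not be equal, so the walk ends with a step back and forth.
    connected : (∀ c → ∃₂ λ r s → col r ≢ c × col s ≢ c × (r ≢ s × parity n ≡ 0ℙ ⊎ col r ≢ col s)) → FSConnected (W n) Y
    connected enough σ τ
      with liftSteps σ refl (swaps-↝ rich (wordOf-↭ σ τ) (proj₂ (↭⇒Swaps (wordOf-↭ σ τ))))
      where
        rich : ∀ c → Rich (wordOf τ) c
        rich c with enough c
        ... | r , s , r≢ , s≢ , inj₁ (ne , e) =
              r , s , ∈-wordOf τ r , ∈-wordOf τ s , r≢ , s≢ , inj₁ (ne , trans (cong parity (length-wordOf τ)) e)
        ... | r , s , r≢ , s≢ , inj₂ ne = r , s , ∈-wordOf τ r , ∈-wordOf τ s , r≢ , s≢ , inj₂ ne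
    ... | σ′ , steps , e with enough (col (σ′ ⟨$⟩ʳ pendant))
    ... | r , _ , r≢ , _ with ∈-wordOf σ′ r
    ... | here refl = contradiction refl r≢
    ... | there r∈ with bichromaticStep (σ′ ⟨$⟩ʳ pendant) _ (Any.map (λ { refl → r≢ }) r∈)
    ... | _ , s with liftStep σ′ refl (path s)
    ... | σ″ , f , _ = steps ◅◅ (_◅_ {j = σ″} f (FSAdj-flip {σ = σ′} {σ′ = σ″} {τ = τ} f (map-≗ e) ◅ ε))

-- The invariant for two classes and odd `n`.

⁻¹-+ˡ : ∀ p q → p ⁻¹ℙ +ℙ q ≡ (p +ℙ q) ⁻¹ℙ
⁻¹-+ˡ 0ℙ q = refl
⁻¹-+ˡ 1ℙ q = sym (⁻¹-involutive q)

⁻¹-+ʳ : ∀ p q → p +ℙ q ⁻¹ℙ ≡ (p +ℙ q) ⁻¹ℙ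
⁻¹-+ʳ 0ℙ q = refl
⁻¹-+ʳ 1ℙ q = refl

+ℙ-leftComm : ∀ p q r → p +ℙ (q +ℙ r) ≡ q +ℙ (p +ℙ r)
+ℙ-leftComm 0ℙ q r = refl
+ℙ-leftComm 1ℙ q r = sym (⁻¹-+ʳ q r)

module Inversions {n : ℕ} where
  gt : Fin n → Fin n → Parity
  gt x y = if toℕ y <ᵇ toℕ x then 1ℙ else 0ℙ

  gt-flip : ∀ {x y} → x ≢ y → gt y x ≡ gt x y ⁻¹ℙ
  gt-flip {x} {y} x≢y = go (toℕ x) (toℕ y) (x≢y ∘ toℕ-injective)
    where
      go : ∀ i j → i ≢ j → (if i <ᵇ j then 1ℙ else 0ℙ) ≡ (if j <ᵇ i then 1ℙ else 0ℙ) ⁻¹ℙ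
      go zero    zero    ne = contradiction refl ne
      go zero    (suc j) ne = refl
      go (suc i) zero    ne = refl
      go (suc i) (suc j) ne = go i j (ne ∘ cong suc)

  below : Fin n → List (Fin n) → Parity
  below x []       = 0ℙ
  below x (y ∷ ys) = gt x y +ℙ below x ys

  inversions : List (Fin n) → Parity
  inversions []       = 0ℙ
  inversions (x ∷ xs) = below x xs +ℙ inversions xs

  below-adj : ∀ z u x y v → below z (u ++ y ∷ x ∷ v) ≡ below z (u ++ x ∷ y ∷ v)
  below-adj z []      x y v = +ℙ-leftComm (gt z y) (gt z x) (below z v)
  below-adj z (w ∷ u) x y v = cong (gt z w +ℙ_) (below-adj z u x y v)

  -- Only the pair `x`, `y` changes its relative order.
  inversions-adj : ∀ u x y v → x ≢ y → inversions (u ++ y ∷ x ∷ v) ≡ inversions (u ++ x ∷ y ∷ v) ⁻¹ℙ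
  inversions-adj [] x y v ne rewrite gt-flip ne = step (gt x y) (below x v) (below y v) (inversions v)
    where
      step : ∀ g p q r → (g ⁻¹ℙ +ℙ q) +ℙ (p +ℙ r) ≡ ((g +ℙ p) +ℙ (q +ℙ r)) ⁻¹ℙ
      step 0ℙ p q r = trans (⁻¹-+ˡ q (p +ℙ r)) (cong _⁻¹ℙ (+ℙ-leftComm q p r))
      step 1ℙ p q r = trans (+ℙ-leftComm q p r)
        (trans (sym (⁻¹-involutive _)) (cong _⁻¹ℙ (sym (⁻¹-+ˡ p (q +ℙ r)))))
  inversions-adj (w ∷ u) x y v ne =
    trans (cong₂ _+ℙ_ (below-adj w u x y v) (inversions-adj u x y v ne)) (⁻¹-+ʳ (below w (u ++ x ∷ y ∷ v)) _)

  inversions-swaps : ∀ {k as bs} → Unique as → Swaps k as bs → inversions bs ≡ parity k +ℙ inversions as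
  inversions-swaps uniq [] = refl
  inversions-swaps {suc k} uniq (s@(adj u x y v) ∷ ss) =
    trans (inversions-swaps (Unique-resp-↭ (Adj⇒↭ s) uniq) ss)
      (trans (cong₂ _+ℙ_ (sym (suc-homo-⁻¹ k)) (inversions-adj u x y v (distinct u uniq)))
        (trans (⁻¹-+ˡ (parity (suc k)) _) (trans (cong _⁻¹ℙ (⁻¹-+ʳ (parity (suc k)) _)) (⁻¹-involutive _))))
    where
      distinct : ∀ u {x y v} → Unique (u ++ x ∷ y ∷ v) → x ≢ y
      distinct []      ((x≢y ∷ _) ∷ _) = x≢y
      distinct (_ ∷ u) (_ ∷ uniq)      = distinct u uniq

-- Each further letter of `ms` costs two transpositions, one on the way out and one on the way back,
-- so the count stays odd.
exchange-swaps : ∀ {A : Set} us (x : A) ms y vs → ∃ λ k → parity k ≡ 1ℙ ×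
                 Swaps k (us ++ x ∷ ms ++ y ∷ vs) (us ++ y ∷ ms ++ x ∷ vs)
exchange-swaps [] x [] y vs = 1 , refl , adj [] x y vs ∷ []
exchange-swaps [] x (m ∷ ms) y vs with exchange-swaps [] x ms y vs
... | k , odd , ss = suc (suc k) , odd ,
      adj [] x m _ ∷ subst (λ j → Swaps j (m ∷ x ∷ ms ++ y ∷ vs) (y ∷ m ∷ ms ++ x ∷ vs)) (+-comm k 1)
        (Swaps-++ (Swaps-∷ m ss) (adj [] m y _ ∷ []))
exchange-swaps (u ∷ us) x ms y vs with exchange-swaps us x ms y vs
... | k , odd , ss = k , odd , Swaps-∷ u ss

module Alternating {V : Set} (h : V → Parity) where
  -- When `h` is the parity of the class and the word follows the route, `evens` counts modulo two
  -- the letters of class 1 on one side of the bipartite `W`.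
  evens odds : List V → Parity
  evens []      = 0ℙ
  evens (x ∷ w) = h x +ℙ odds w
  odds []      = 0ℙ
  odds (x ∷ w) = evens w

  -- As `ms` has even length, exactly one of the two places is counted, and the letter there changes
  -- its `h`.
  evens-exchange : ∀ us x ms y vs → parity (length ms) ≡ 0ℙ → h y ≡ h x ⁻¹ℙ →
                   evens (us ++ y ∷ ms ++ x ∷ vs) ≡ evens (us ++ x ∷ ms ++ y ∷ vs) ⁻¹ℙ
  odds-exchange  : ∀ us x ms y vs → parity (length ms) ≡ 0ℙ → h y ≡ h x ⁻¹ℙ →
                   odds (us ++ y ∷ ms ++ x ∷ vs) ≡ odds (us ++ x ∷ ms ++ y ∷ vs) ⁻¹ℙ
  evens-exchange [] x [] y vs even e rewrite e = ⁻¹-+ˡ (h x) (evens vs)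
  evens-exchange [] x (a ∷ b ∷ ms) y vs even e = trans (+ℙ-leftComm (h y) (h b) _)
    (trans (cong (h b +ℙ_) (evens-exchange [] x ms y vs even e))
      (trans (⁻¹-+ʳ (h b) _) (cong _⁻¹ℙ (+ℙ-leftComm (h b) (h x) _))))
  evens-exchange (u ∷ us) x ms y vs even e = trans (cong (h u +ℙ_) (odds-exchange us x ms y vs even e)) (⁻¹-+ʳ (h u) _)
  odds-exchange [] x [] y vs even e rewrite e =
    sym (trans (cong _⁻¹ℙ (⁻¹-+ˡ (h x) (odds vs))) (⁻¹-involutive _))
  odds-exchange [] x (a ∷ b ∷ ms) y vs even e =
    trans (cong (h a +ℙ_) (odds-exchange [] x ms y vs even e)) (⁻¹-+ʳ (h a) _)
  odds-exchange (u ∷ us) x ms y vs even e = evens-exchange us x ms y vs even e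

tabulate-split : ∀ {A : Set} n (f : Fin (suc n) → A) i → ∃₂ λ us vs → tabulate f ≡ us ++ f (inject₁ i) ∷ f (suc i) ∷ vs
tabulate-split (suc n) f zero = [] , _ , refl
tabulate-split (suc n) f (suc i) with tabulate-split n (f ∘ suc) i
... | us , vs , e = f zero ∷ us , vs , cong (f zero ∷_) e

block-+ : ∀ k ks j → block (k ∷ ks) (k + j) ≡ suc (block ks j)
block-+ zero    ks j = refl
block-+ (suc k) ks j = block-+ k ks j

block-< : ∀ {k} ks {j} → j < k → block (k ∷ ks) j ≡ 0
block-< {suc k} ks {zero}  p       = refl
block-< {suc k} ks {suc j} (s≤s p) = block-< {k} ks p

block-pair : ∀ k k′ i → i < k + k′ → block (k ∷ k′ ∷ []) i ≤ 1
block-pair zero    k′ i       p       = s≤s (≤-reflexive (block-< [] p))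
block-pair (suc k) k′ zero    p       = z≤n
block-pair (suc k) k′ (suc i) (s≤s p) = block-pair k k′ i p

parity-differ : ∀ {i j} → i ≤ 1 → j ≤ 1 → i ≢ j → parity j ≡ parity i ⁻¹ℙ
parity-differ {0} {0} _ _ ne = contradiction refl ne
parity-differ {0} {1} _ _ ne = refl
parity-differ {1} {0} _ _ ne = refl
parity-differ {1} {1} _ _ ne = contradiction refl ne
parity-differ {suc (suc _)} (s≤s ()) _
parity-differ {0} {suc (suc _)} _ (s≤s ())
parity-differ {1} {suc (suc _)} _ (s≤s ())

module Bipartite (l k k′ : ℕ) (sum≡n : k + k′ ≡ 3 + l) (l-even : parity l ≡ 0ℙ) where
  open Hamiltonian l
  open Colouring (k ∷ k′ ∷ [])
  open Inversions {n}
  open Alternating {V} (parity ∘ col)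

  -- For odd n the route alternates between the two sides of W, so an even number of vertices lies between
  -- the ends of an edge.
  Exchangeable : V → V → Set
  Exchangeable x y = ∃₂ λ us ms → ∃ λ vs → parity (length ms) ≡ 0ℙ × route ≡ us ++ x ∷ ms ++ y ∷ vs

  dir-exchangeable : ∀ x y → WDir n (toℕ x) (toℕ y) → Exchangeable x y ⊎ Exchangeable y x
  dir-exchangeable x y (inj₁ (e , y<))
    with tabulate-split (suc l) (inject₁ {2 + l}) (fromℕ< (s≤s⁻¹ (subst (_< 2 + l) e y<)))
  ... | us , vs , r = inj₁ (pendant ∷ us , [] , vs , refl ,
        cong (pendant ∷_) (trans r (cong₂ (λ a b → us ++ a ∷ b ∷ vs)
          (toℕ-injective (trans (toℕ-inject₁ _) (trans (toℕ-inject₁ _) (toℕ-fromℕ< _))))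
          (toℕ-injective (trans (cong suc (trans (toℕ-inject₁ _) (toℕ-fromℕ< _))) (sym e))))))
  -- The chord encloses the `l` vertices of `middle`, an even number because `n` is `3 + l`.
  dir-exchangeable x y (inj₂ (inj₁ (e , e′))) = inj₁ (pendant ∷ [] , middle , [] ,
    trans (cong parity (length-tabulate {n = l} (λ i → inject₁ (suc (inject₁ i))))) l-even ,
    trans route-ends (cong₂ (λ a b → pendant ∷ a ∷ middle ++ b ∷ []) (sym (toℕ-injective e))
      (toℕ-injective (trans (toℕ-inject₁ (suc (fromℕ l))) (trans (cong suc (toℕ-fromℕ l)) (sym e′))))))
  -- The route meets the pendant vertex before vertex 0, hence the reversed order.
  dir-exchangeable x y (inj₂ (inj₂ (e , e′))) = inj₂ ([] , [] , _ , refl ,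
    cong₂ (λ a b → a ∷ b ∷ tabulate (λ i → inject₁ (suc i)))
      (toℕ-injective (trans (toℕ-fromℕ (2 + l)) (sym e′))) (toℕ-injective (sym e)))

  exchangeable : ∀ x y → W n x y → Exchangeable x y ⊎ Exchangeable y x
  exchangeable x y (inj₁ d) = dir-exchangeable x y d
  exchangeable x y (inj₂ d) = Sum.swap (dir-exchangeable y x d)

  col≤1 : ∀ v → col v ≤ 1
  col≤1 v = block-pair k k′ (toℕ v) (subst (toℕ v <_) (sym sum≡n) (toℕ<n v))

  invariant : List V → Parity
  invariant w = inversions w +ℙ evens w

  -- Both summands flip: an exchange is an odd permutation, and it moves letters of different
  -- classes between the sides of `W`.
  invariant-exchange : ∀ (σ σ′ : Permutation′ n) {x y} → Exchangeable x y → Y (σ ⟨$⟩ʳ x) (σ ⟨$⟩ʳ y) →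
    σ′ ⟨$⟩ʳ x ≡ σ ⟨$⟩ʳ y → σ′ ⟨$⟩ʳ y ≡ σ ⟨$⟩ʳ x → (∀ z → z ≢ x → z ≢ y → σ′ ⟨$⟩ʳ z ≡ σ ⟨$⟩ʳ z) →
    invariant (wordOf σ′) ≡ invariant (wordOf σ)
  invariant-exchange σ σ′ {x} {y} (us , ms , vs , even , r) ne e₁ e₂ e₃
    with exchange-swaps (map (σ ⟨$⟩ʳ_) us) (σ ⟨$⟩ʳ x) (map (σ ⟨$⟩ʳ_) ms) (σ ⟨$⟩ʳ y) (map (σ ⟨$⟩ʳ_) vs)
  ... | j , odd , ss = begin
      invariant (wordOf σ′)                    ≡⟨ cong invariant w′ ⟩
      inversions after +ℙ evens after          ≡⟨ cong₂ _+ℙ_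
          (trans (inversions-swaps (subst Unique w (wordOf-unique σ)) ss) (cong (_+ℙ inversions before) odd))
          (evens-exchange f-us _ f-ms _ f-vs (trans (cong parity (length-map f ms)) even)
            (parity-differ (col≤1 (f x)) (col≤1 (f y)) ne)) ⟩
      inversions before ⁻¹ℙ +ℙ evens before ⁻¹ℙ ≡⟨ ⁻¹-+ˡ (inversions before) _ ⟩
      (inversions before +ℙ evens before ⁻¹ℙ) ⁻¹ℙ ≡⟨ cong _⁻¹ℙ (⁻¹-+ʳ (inversions before) _) ⟩
      (invariant before ⁻¹ℙ) ⁻¹ℙ               ≡⟨ ⁻¹-involutive _ ⟩
      invariant before                         ≡⟨ cong invariant w ⟨
      invariant (wordOf σ)                     ∎
    where
      open ≡-Reasoning
      f : V → V
      f = σ ⟨$⟩ʳ_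
      f-us f-ms f-vs before after : List V
      f-us = map f us
      f-ms = map f ms
      f-vs = map f vs
      before = f-us ++ f x ∷ f-ms ++ f y ∷ f-vs
      after = f-us ++ f y ∷ f-ms ++ f x ∷ f-vs
      w : wordOf σ ≡ before
      w = trans (cong (map f) r) (trans (map-++ f us _) (cong (λ z → f-us ++ f x ∷ z) (map-++ f ms _)))
      w′ : wordOf σ′ ≡ after
      w′ = trans (cong (map (σ′ ⟨$⟩ʳ_)) r) (map-exchange f (σ′ ⟨$⟩ʳ_) us ms vs (subst Unique r route-unique) e₁ e₂ e₃)

  invariant-FSAdj : ∀ {σ σ′} → FSAdj (W n) Y σ σ′ → invariant (wordOf σ′) ≡ invariant (wordOf σ)
  invariant-FSAdj {σ} {σ′} (x , y , w , ne , e₁ , e₂ , e₃) with exchangeable x y w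
  ... | inj₁ ex = invariant-exchange σ σ′ ex ne e₁ e₂ e₃
  ... | inj₂ ex = invariant-exchange σ σ′ ex (≢-sym ne) e₂ e₁ (λ z p q → e₃ z q p)

  invariant-Star : ∀ {σ τ} → Star (FSAdj (W n) Y) σ τ → invariant (wordOf τ) ≡ invariant (wordOf σ)
  invariant-Star ε = refl
  invariant-Star (_◅_ {i} {j} s ss) = trans (invariant-Star ss) (invariant-FSAdj {i} {j} s)

  -- The first and third places of the route lie on the same side of `W`. Transposing them flips the
  -- inversion parity but keeps `evens`, so `τ` cannot be reached from the identity.
  disconnected : ¬ FSConnected (W n) Y
  disconnected conn with exchange-swaps [] pendant (zero ∷ []) (suc zero) (tabulate {n = l} (λ i → inject₁ (suc (suc i))))
  ... | j , odd , ss = p≢p⁻¹ (invariant route) (begin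
      invariant route                      ≡⟨ cong invariant (map-id route) ⟨
      invariant (wordOf idₚ)               ≡⟨ invariant-Star (conn idₚ τ) ⟨
      invariant (wordOf τ)                 ≡⟨ cong invariant w ⟩
      inversions after +ℙ evens after      ≡⟨ cong₂ _+ℙ_
          (trans (inversions-swaps route-unique ss) (cong (_+ℙ inversions route) odd))
          (+ℙ-leftComm (parity (col (suc zero))) (parity (col pendant)) _) ⟩
      inversions route ⁻¹ℙ +ℙ evens route  ≡⟨ ⁻¹-+ˡ (inversions route) _ ⟩
      invariant route ⁻¹ℙ                  ∎)
    where
      open ≡-Reasoning
      τ : Permutation′ n
      τ = transpose pendant (suc zero)
      rest after : List V
      rest = tabulate {n = l} (λ i → inject₁ (suc (suc i)))
      after = suc zero ∷ zero ∷ pendant ∷ rest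
      w : wordOf τ ≡ after
      w = trans (map-exchange id (τ ⟨$⟩ʳ_) [] (zero ∷ []) rest route-unique (transpose-i pendant (suc zero))
                  (transpose-j pendant (suc zero)) (transpose-k pendant (suc zero)))
            (cong (λ z → suc zero ∷ zero ∷ pendant ∷ z) (map-id rest))

-- Choice of witnesses in the blocks, and the theorem.

parity≡0⇒2∣ : ∀ n → parity n ≡ 0ℙ → 2 ∣ n
parity≡0⇒2∣ zero          e = 2 ∣0
parity≡0⇒2∣ (suc (suc n)) e = ∣m∣n⇒∣m+n ∣-refl (parity≡0⇒2∣ n e)

2∣⇒parity≡0 : ∀ {n} → 2 ∣ n → parity n ≡ 0ℙ
2∣⇒parity≡0 (divides q refl) = trans (*-homo-* q 2) (*-zeroʳ (parity q))

module Witnesses (l : ℕ) (ks : List ℕ) where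
  open Hamiltonian l
  open Colouring ks

  at : ∀ {j b} → j < n → block ks j ≡ b → ∃ λ v → toℕ v ≡ j × col v ≡ b
  at p e = fromℕ< p , toℕ-fromℕ< p , trans (cong (block ks) (toℕ-fromℕ< p)) e

≢-resp-≡ : ∀ {i j a b : ℕ} → i ≡ a → j ≡ b → a ≢ b → i ≢ j
≢-resp-≡ refl refl a≢b = a≢b

-- The first vertices of the first three blocks have three different classes, so two of them avoid
-- any given `c`.
connected-threeBlocks : ∀ l k₁ k₂ k₃ ks → 1 ≤ k₁ → 1 ≤ k₂ → 1 ≤ k₃ → k₁ + k₂ < 3 + l →
                        FSConnected (W (3 + l)) (CompleteMultipartite (3 + l) (k₁ ∷ k₂ ∷ k₃ ∷ ks))
connected-threeBlocks l k₁ k₂ k₃ ks 1≤k₁ 1≤k₂ 1≤k₃ k₁+k₂<n = connected enough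
  where
    open Hamiltonian l
    open Colouring (k₁ ∷ k₂ ∷ k₃ ∷ ks)
    open Witnesses l (k₁ ∷ k₂ ∷ k₃ ∷ ks)
    first : ∃ λ v → toℕ v ≡ 0 × col v ≡ 0
    first = at (s≤s z≤n) (block-< (k₂ ∷ k₃ ∷ ks) 1≤k₁)
    second : ∃ λ v → toℕ v ≡ k₁ + 0 × col v ≡ 1
    second = at (<-≤-trans (s≤s (+-monoʳ-≤ k₁ z≤n)) k₁+k₂<n)
      (trans (block-+ k₁ (k₂ ∷ k₃ ∷ ks) 0) (cong suc (block-< (k₃ ∷ ks) 1≤k₂)))
    third : ∃ λ v → toℕ v ≡ k₁ + (k₂ + 0) × col v ≡ 2
    third = at (subst (λ j → k₁ + j < n) (sym (+-identityʳ k₂)) k₁+k₂<n)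
      (trans (block-+ k₁ (k₂ ∷ k₃ ∷ ks) (k₂ + 0))
        (cong suc (trans (block-+ k₂ (k₃ ∷ ks) 0) (cong suc (block-< ks 1≤k₃)))))
    enough : ∀ c → ∃₂ λ r s → col r ≢ c × col s ≢ c × (r ≢ s × parity n ≡ 0ℙ ⊎ col r ≢ col s)
    enough c with first | second | third
    enough 0 | _ | s , _ , es | t , _ , et = s , t ,
      ≢-resp-≡ es refl (λ ()) , ≢-resp-≡ et refl (λ ()) , inj₂ (≢-resp-≡ es et (λ ()))
    enough 1 | r , _ , er | _ | t , _ , et = r , t ,
      ≢-resp-≡ er refl (λ ()) , ≢-resp-≡ et refl (λ ()) , inj₂ (≢-resp-≡ er et (λ ()))
    enough (suc (suc c)) | r , _ , er | s , _ , es | _ = r , s ,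
      ≢-resp-≡ er refl (λ ()) , ≢-resp-≡ es refl (λ ()) , inj₂ (≢-resp-≡ er es (λ ()))

connected-twoBlocks : ∀ l k₁ k₂ → 2 ≤ k₁ → 2 ≤ k₂ → k₁ + k₂ ≡ 3 + l → parity (3 + l) ≡ 0ℙ →
                      FSConnected (W (3 + l)) (CompleteMultipartite (3 + l) (k₁ ∷ k₂ ∷ []))
connected-twoBlocks l k₁ k₂ 2≤k₁ 2≤k₂ sum≡n even = connected enough
  where
    open Hamiltonian l
    open Colouring (k₁ ∷ k₂ ∷ [])
    open Witnesses l (k₁ ∷ k₂ ∷ [])
    inFirst : ∀ {j} → j < k₁ → ∃ λ v → toℕ v ≡ j × col v ≡ 0
    inFirst j<k₁ = at (<-≤-trans j<k₁ (≤-trans (m≤m+n k₁ k₂) (≤-reflexive sum≡n))) (block-< (k₂ ∷ []) j<k₁)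
    inSecond : ∀ {j} → j < k₂ → ∃ λ v → toℕ v ≡ k₁ + j × col v ≡ 1
    inSecond {j} j<k₂ = at (<-≤-trans (+-monoʳ-< k₁ j<k₂) (≤-reflexive sum≡n))
      (trans (block-+ k₁ (k₂ ∷ []) j) (cong suc (block-< [] j<k₂)))
    -- Whichever block `c` names, the other one supplies its first two vertices.
    enough : ∀ c → ∃₂ λ r s → col r ≢ c × col s ≢ c × (r ≢ s × parity n ≡ 0ℙ ⊎ col r ≢ col s)
    enough 0 with inSecond (<-≤-trans (s≤s z≤n) 2≤k₂) | inSecond 2≤k₂
    ... | r , nr , er | s , ns , es = r , s , ≢-resp-≡ er refl (λ ()) , ≢-resp-≡ es refl (λ ()) ,
          inj₁ ((λ { refl → 0≢1+n (+-cancelˡ-≡ k₁ 0 1 (trans (sym nr) ns)) }) , even)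
    enough (suc c) with inFirst (<-≤-trans (s≤s z≤n) 2≤k₁) | inFirst 2≤k₁
    ... | r , nr , er | s , ns , es = r , s , ≢-resp-≡ er refl (λ ()) , ≢-resp-≡ es refl (λ ()) ,
          inj₁ ((λ { refl → 0≢1+n (trans (sym nr) ns) }) , even)

theorem3p4 : (n : ℕ) → 4 ≤ n → (t : ℕ) → 2 ≤ t → (ks : Vec ℕ t)
    → ((i : Fin t) → 1 ≤ lookup ks i)
    → ((i j : Fin t) → i ≤ᶠ j → lookup ks i ≤ lookup ks j)
    → ((i : Fin t) → suc (lookup ks i) < n)
    → sum ks ≡ n
    → FSConnected (W n) (CompleteMultipartite n (toList ks)) ⇔ (2 ∣ n ⊎ 2 < t)
theorem3p4 _ (s≤s (s≤s (s≤s (s≤s {n = l} _)))) 2 _ (k₁ ∷ k₂ ∷ []) _ _ k<n-1 sum≡n = mk⇔ onlyIf if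
  where
    k₁+k₂≡n : k₁ + k₂ ≡ 4 + l
    k₁+k₂≡n = trans (cong (k₁ +_) (sym (+-identityʳ k₂))) sum≡n
    -- A class smaller than `n - 1` leaves at least two vertices for the other.
    2≤ : ∀ {i j} → i + j ≡ 4 + l → suc j < 4 + l → 2 ≤ i
    2≤ {i} {j} e p = +-cancelʳ-≤ j 2 i (≤-trans p (≤-reflexive (sym e)))
    onlyIf : FSConnected (W (4 + l)) (CompleteMultipartite (4 + l) (k₁ ∷ k₂ ∷ [])) → 2 ∣ 4 + l ⊎ 2 < 2
    onlyIf conn with parity l in e
    ... | 0ℙ = inj₁ (parity≡0⇒2∣ (4 + l) e)
    ... | 1ℙ = contradiction conn (Bipartite.disconnected (suc l) k₁ k₂ k₁+k₂≡n (parity-suc (suc l) e))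
    if : 2 ∣ 4 + l ⊎ 2 < 2 → FSConnected (W (4 + l)) (CompleteMultipartite (4 + l) (k₁ ∷ k₂ ∷ []))
    if (inj₂ (s≤s (s≤s ())))
    if (inj₁ 2∣n) = connected-twoBlocks (suc l) k₁ k₂ (2≤ k₁+k₂≡n (k<n-1 (suc zero)))
      (2≤ (trans (+-comm k₂ k₁) k₁+k₂≡n) (k<n-1 zero)) k₁+k₂≡n (2∣⇒parity≡0 2∣n)
theorem3p4 _ (s≤s (s≤s (s≤s _))) (suc (suc (suc t))) _ (k₁ ∷ k₂ ∷ k₃ ∷ ks) 1≤k _ _ sum≡n =
  mk⇔ (λ _ → inj₂ (s≤s (s≤s (s≤s z≤n)))) λ _ →
    connected-threeBlocks _ k₁ k₂ k₃ (toList ks) (1≤k zero) (1≤k (suc zero)) (1≤k (suc (suc zero)))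
      (<-≤-trans (+-monoʳ-< k₁ (m<m+n k₂ (<-≤-trans (1≤k (suc (suc zero))) (m≤m+n k₃ (sum ks))))) (≤-reflexive sum≡n))
theorem3p4 _ _ 1 (s≤s ())
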